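{- Let $k$ be a non-negative integer and let $G$ be an edge-colored graph on $n$ vertices with $n\geq 3k$. If $m(G)+c(G)\geq\binom{n+1}{2}+k-1$ and $G$ contains exactly $k$ rainbow triangles, then $G\in\mathcal{G}_k$.
   Context: Graphs are finite, simple, undirected and have at least one vertex. An edge-colored graph is a graph together with an arbitrary (not necessarily proper) assignment of a color to each edge. $m(G)$ denotes the number of edges of $G$, and $c(G)$ denotes the number of distinct colors that actually appear on the edges of $G$. A subgraph is rainbow if all its edges have pairwise distinct colors; rainbow triangles are counted as distinct subgraphs (by their vertex sets). The classes $\mathcal{G}_k$ ($k\ge 0$ an integer) are defined recursively (simultaneously for all $k$, by recursion on the number of vertices): an edge-colored graph $G$ on $n$ vertices belongs to $\mathcal{G}_k$ if and only if $G$ is a complete graph, $G$ contains exactly $k$ rainbow triangles, $c(G)=n+k-1$, and one of the following holds: (a) $G$ is a single vertex; (b) $G$ is a rainbow triangle; (c) there is a partition $(V_1,V_2)$ of the vertex set of $G$ into two non-empty sets such that all edges of $G$ between $V_1$ and $V_2$ have the same color, $G[V_1]\in\mathcal{G}_i$ and $G[V_2]\in\mathcal{G}_j$ for some non-negative integers $i,j$ with $i+j=k$. Here $G[V_i]$ is the induced subgraph with the inherited edge coloring. -}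

module Defs where

open import Data.Bool.Base using (true; false)
open import Data.Fin.Base using (Fin; zero; suc; _<_)
open import Data.Fin.Properties using (_<?_)
open import Data.Fin.Subset using (Subset; ∣_∣; ∁; Nonempty; _∈_)
open import Data.List.Base
  using (List; length; filter; mapMaybe; deduplicate; allFin; cartesianProduct)
open import Data.Maybe.Base using (Maybe; nothing)
open import Data.Maybe using (Is-just)
open import Data.Maybe.Properties using (≡-dec)
import Data.Maybe.Relation.Unary.Any as Any
open import Data.Nat.Base using (ℕ; _+_; _∸_)
open import Data.Product.Base using (_×_; _,_; uncurry)
open import Data.Unit.Base using (tt)
open import Data.Vec.Base using (_∷_)
open import Level using (Level)
open import Relation.Binary.Definitions using (DecidableEquality)
open import Relation.Binary.PropositionalEquality.Core using (_≡_; _≢_)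
open import Relation.Nullary.Decidable.Core using (Dec; yes; _×-dec_; ¬?)

-- The elements of a subset, listed in increasing order.
elements : ∀ {n} (S : Subset n) → Fin ∣ S ∣ → Fin n
elements (true  ∷ S) zero    = zero
elements (true  ∷ S) (suc i) = suc (elements S i)
elements (false ∷ S) i       = suc (elements S i)

module EdgeColored {ℓ : Level} {Color : Set ℓ} (_≟_ : DecidableEquality Color) where

  -- `color u v` is `just a` if uv is an edge of color a, and `nothing` if uv
  -- is not an edge.  The case n = 0 is not excluded here.
  record Graph (n : ℕ) : Set ℓ where
    field
      color     : Fin n → Fin n → Maybe Color
      symmetric : ∀ u v → color u v ≡ color v u
      loopless  : ∀ v → color v v ≡ nothing

    Adj : Fin n → Fin n → Set ℓ
    Adj u v = Is-just (color u v)

    Adj? : ∀ u v → Dec (Adj u v)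
    Adj? u v = Any.dec (λ _ → yes tt) (color u v)

  open Graph

  module _ {n : ℕ} (G : Graph n) where

    -- Each undirected edge occurs once, with its smaller endpoint first.
    edges : List (Fin n × Fin n)
    edges = filter (λ (u , v) → (u <? v) ×-dec Adj? G u v)
                   (cartesianProduct (allFin n) (allFin n))

    m : ℕ
    m = length edges

    c : ℕ
    c = length (deduplicate _≟_ (mapMaybe (uncurry (color G)) edges))

    RainbowTriangle : Fin n → Fin n → Fin n → Set ℓ
    RainbowTriangle u v w =
      (Adj G u v × Adj G v w × Adj G u w) ×
      (color G u v ≢ color G v w ×
       color G u v ≢ color G u w ×
       color G v w ≢ color G u w)

    RainbowTriangle? : ∀ u v w → Dec (RainbowTriangle u v w)
    RainbowTriangle? u v w =
      (Adj? G u v ×-dec Adj? G v w ×-dec Adj? G u w) ×-dec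
      (¬? (≡-dec _≟_ (color G u v) (color G v w)) ×-dec
       ¬? (≡-dec _≟_ (color G u v) (color G u w)) ×-dec
       ¬? (≡-dec _≟_ (color G v w) (color G u w)))

    -- Triangles are counted by vertex set, hence u < v < w.
    rainbowTriangles : List (Fin n × Fin n × Fin n)
    rainbowTriangles =
      filter (λ (u , v , w) → (u <? v) ×-dec (v <? w) ×-dec RainbowTriangle? u v w)
             (cartesianProduct (allFin n) (cartesianProduct (allFin n) (allFin n)))

    #rainbowTriangles : ℕ
    #rainbowTriangles = length rainbowTriangles

    Complete : Set ℓ
    Complete = ∀ u v → u ≢ v → Adj G u v

    MonochromaticBetween : Subset n → Subset n → Set ℓ
    MonochromaticBetween V₁ V₂ =
      ∀ {u v u′ v′} → u ∈ V₁ → v ∈ V₂ → u′ ∈ V₁ → v′ ∈ V₂ →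
      Adj G u v → Adj G u′ v′ → color G u v ≡ color G u′ v′

    -- The induced subgraph, with its vertices renumbered by `elements`.
    induced : (S : Subset n) → Graph ∣ S ∣
    induced S .color i j     = color G (elements S i) (elements S j)
    induced S .symmetric i j = symmetric G (elements S i) (elements S j)
    induced S .loopless i    = loopless G (elements S i)

  mutual

    -- Both parts of a partition are non-empty, so the recursion is on the
    -- number of vertices and the inductive reading is the recursive one.
    -- `Shape` has no inhabitant at n = 0, so the subtraction never truncates.
    record 𝒢 (k : ℕ) {n : ℕ} (G : Graph n) : Set ℓ where
      inductive
      field
        complete    : Complete G
        #triangles  : #rainbowTriangles G ≡ k
        #colors     : c G ≡ n + k ∸ 1
        shape       : Shape k G

    data Shape (k : ℕ) {n : ℕ} (G : Graph n) : Set ℓ where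
      singleVertex    : n ≡ 1 → Shape k G
      rainbowTriangle : n ≡ 3 → ∀ {u v w} → RainbowTriangle G u v w → Shape k G
      partition       : (V₁ : Subset n) → Nonempty V₁ → Nonempty (∁ V₁) →
                        MonochromaticBetween G V₁ (∁ V₁) →
                        ∀ {i j} → 𝒢 i (induced G V₁) → 𝒢 j (induced G (∁ V₁)) → i + j ≡ k →
                        Shape k G

{-# OPTIONS --safe #-}
module Submission where

-- Write t for the number of rainbow triangles and e for the number of non-edges.
-- The hypothesis says n + t + e ≤ c + 1, and by induction on n one shows both
-- c < n + t + e and that c + 1 = n + t + e puts G in 𝒢 t; call G extremal then.
--
-- Delete a vertex v with the most non-neighbors, and choose edges v x, v x₁, …,
-- v xₛ₋₁ representing the s colors that occur only at v.  Each xᵢ adjacent to x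
-- spans a rainbow triangle with v and x, and x has no more non-neighbors than v.
-- So at least s − 1 rainbow triangles and non-edges disappear with v, which gives
-- the bound.
--
-- In the equality case G − v is extremal, hence complete; then G is complete
-- too, and the triangles v x xᵢ are all the rainbow triangles at v.  So v and
-- the vertices joined to v by colors occurring only at v form a module M.  If
-- M is not everything, then G restricted to v and the complement of M is
-- again extremal, and its monochromatic cut extends to G.  If M is everything,
-- then either v is cut off by a single color or G is a rainbow triangle.  Both
-- sides of a monochromatic cut of G are extremal.

open import Defs
open import Data.Bool.Base using (true; false)
open import Data.Empty using (⊥; ⊥-elim)
open import Data.Fin.Base as Fin using (Fin; zero; suc)
import Data.Fin.Properties as Fin
open import Data.Fin.Subset using (Subset; ∣_∣; ∁; ⁅_⁆; _∪_; Nonempty)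
  renaming (_∈_ to _∈ₛ_; _∉_ to _∉ₛ_)
import Data.Fin.Subset.Properties as Subset
open import Data.List.Base
  using (List; []; _∷_; _++_; length; map; filter; mapMaybe; deduplicate; allFin; cartesianProduct)
open import Data.List.Properties using (length-map; length-++; length-tabulate)
import Data.List.Extrema as Extrema
import Data.List.Membership.DecPropositional as DecMembership
open import Data.List.Membership.Propositional using (_∈_; _∉_)
open import Data.List.Membership.Propositional.Properties
open import Data.List.Relation.Binary.Permutation.Propositional
  using (_↭_; refl; prep; swap; ↭-sym; ↭-trans)
open import Data.List.Relation.Binary.Permutation.Propositional.Properties
  using (↭-length; shift; ∈-resp-↭; drop-∷; ↭-singleton-inv)
open import Data.List.Relation.Binary.Subset.Propositional using (_⊆_)
open import Data.List.Relation.Unary.All as All using (All; []; _∷_)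
open import Data.List.Relation.Unary.AllPairs as AllPairs using ([]; _∷_)
open import Data.List.Relation.Unary.Any using (here; there)
open import Data.List.Relation.Unary.Unique.DecPropositional.Properties using (deduplicate-!)
open import Data.List.Relation.Unary.Unique.Propositional using (Unique)
import Data.List.Relation.Unary.Unique.Propositional.Properties as Unique
open import Data.List.Relation.Unary.Any.Properties using (singleton⁻)
open import Data.Maybe using (Is-just)
open import Data.Maybe.Base using (Maybe; just; nothing)
open import Data.Maybe.Properties using (just-injective; ≡-dec)
import Data.Maybe.Relation.Unary.Any as Maybe
open import Data.Nat.Base
  using (ℕ; zero; suc; NonZero; >-nonZero⁻¹; _+_; _*_; _∸_; _≤_; _<_; _≥_; z≤n; s≤s)
open import Data.Nat.Combinatorics using (_C_; nCk+nC[k+1]≡[n+1]C[k+1]; nC1≡n)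
open import Data.Nat.Induction using (<-rec)
import Data.Nat.Properties as ℕ
open import Data.Nat.Tactic.RingSolver using (solve-∀)
open import Data.Product.Base using (_×_; _,_; ∃; ∃₂; proj₁; proj₂; uncurry)
open import Data.Product.Properties as Product using (,-injective)
open import Data.Sum.Base using (inj₁; inj₂)
open import Data.Unit.Base using (tt)
open import Data.Vec.Base using ([]; _∷_; here; there; tabulate)
import Data.Vec.Properties as Vec
open import Function.Base using (_∘_; id)
open import Level using (Level)
open import Relation.Binary.Definitions using (DecidableEquality; tri<; tri≈; tri>)
open import Relation.Binary.PropositionalEquality
open import Relation.Nullary using (¬_; Dec; yes; no; does; contradiction; _×-dec_; ¬?)
open import Relation.Nullary.Decidable using (dec-true; decidable-stable)

-- Counting in duplicate-free lists.

module _ {a} {A : Set a} where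

  Unique-⊆⇒length≤ : {xs ys : List A} → Unique xs → xs ⊆ ys → length xs ≤ length ys
  Unique-⊆⇒length≤ {[]}     _          _     = z≤n
  Unique-⊆⇒length≤ {x ∷ xs} (x∉ ∷ xs!) xs⊆ys
    with as , bs , refl ← ∈-∃++ (xs⊆ys (here refl)) = begin
      suc (length xs)         ≤⟨ s≤s (Unique-⊆⇒length≤ xs! rest) ⟩
      suc (length (as ++ bs)) ≡⟨ ↭-length (shift x as bs) ⟨
      length (as ++ x ∷ bs)   ∎
    where
    open ℕ.≤-Reasoning
    rest : xs ⊆ as ++ bs
    rest z∈xs with ∈-resp-↭ (shift x as bs) (xs⊆ys (there z∈xs))
    ... | here refl = contradiction refl (All.lookup x∉ z∈xs)
    ... | there z∈  = z∈

  Unique-⊆-++⇒length≤ : {xs : List A} (ys : List A) {zs : List A} →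
                        Unique xs → xs ⊆ ys ++ zs → length xs ≤ length ys + length zs
  Unique-⊆-++⇒length≤ ys xs! xs⊆ =
    ℕ.≤-trans (Unique-⊆⇒length≤ xs! xs⊆) (ℕ.≤-reflexive (length-++ ys))

module _ {a b} {A : Set a} {B : Set b} {f : A → B} where

  -- The pattern behind every count of losses: `f` embeds the objects of an induced subgraph into
  -- those of `G`, and `ls` lists further objects of `G` that the embedding misses.
  injective-disjoint⇒length≤ :
    {xs : List A} {ls ys : List B} → (∀ {x y} → f x ≡ f y → x ≡ y) →
    Unique xs → Unique ls → (∀ {x} → x ∈ xs → f x ∈ ys) → ls ⊆ ys →
    (∀ {x} → x ∈ xs → f x ∉ ls) → length xs + length ls ≤ length ys
  injective-disjoint⇒length≤ {xs} {ls} {ys} inj xs! ls! xs⊆ ls⊆ disjoint = begin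
    length xs + length ls         ≡⟨ cong (_+ length ls) (length-map f xs) ⟨
    length (map f xs) + length ls ≡⟨ length-++ (map f xs) ⟨
    length (map f xs ++ ls)       ≤⟨ Unique-⊆⇒length≤ unique sub ⟩
    length ys                     ∎
    where
    open ℕ.≤-Reasoning
    unique : Unique (map f xs ++ ls)
    unique = Unique.++⁺ (Unique.map⁺ inj xs!) ls!
      λ { (z∈map , z∈ls) → let _ , x∈ , z≡ = ∈-map⁻ f z∈map in
          disjoint x∈ (subst (_∈ ls) z≡ z∈ls) }
    sub : map f xs ++ ls ⊆ ys
    sub z∈ with ∈-++⁻ (map f xs) z∈
    ... | inj₂ z∈ls = ls⊆ z∈ls
    ... | inj₁ z∈map with _ , x∈ , refl ← ∈-map⁻ f z∈map = xs⊆ x∈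

module _ {a b} {A : Set a} {B : Set b} (f : A → Maybe B) where

  ∈-mapMaybe⁺ : ∀ {xs x y} → x ∈ xs → f x ≡ just y → y ∈ mapMaybe f xs
  ∈-mapMaybe⁺ {x ∷ xs} (here refl) fx≡ with just _ ← f x | refl ← fx≡ = here refl
  ∈-mapMaybe⁺ {x ∷ xs} (there x∈)  fx≡ with f x
  ... | just _  = there (∈-mapMaybe⁺ x∈ fx≡)
  ... | nothing = ∈-mapMaybe⁺ x∈ fx≡

  ∈-mapMaybe⁻ : ∀ xs {y} → y ∈ mapMaybe f xs → ∃ λ x → x ∈ xs × f x ≡ just y
  ∈-mapMaybe⁻ (x ∷ xs) y∈ with f x in fx≡
  ∈-mapMaybe⁻ (x ∷ xs) (here refl) | just _ = x , here refl , fx≡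
  ∈-mapMaybe⁻ (x ∷ xs) (there y∈)  | just _ = let z , z∈ , eq = ∈-mapMaybe⁻ xs y∈ in z , there z∈ , eq
  ∈-mapMaybe⁻ (x ∷ xs) y∈          | nothing = let z , z∈ , eq = ∈-mapMaybe⁻ xs y∈ in z , there z∈ , eq

-- The increasing enumeration of a subset.

elements-∈ : ∀ {n} (S : Subset n) i → elements S i ∈ₛ S
elements-∈ (true  ∷ S) zero    = here
elements-∈ (true  ∷ S) (suc i) = there (elements-∈ S i)
elements-∈ (false ∷ S) i       = there (elements-∈ S i)

-- Non-edges and triangles are listed with increasing vertices, so monotonicity carries the entries
-- for an induced subgraph to entries for `G` without sorting again.
elements-mono-< : ∀ {n} (S : Subset n) {i j} → i Fin.< j → elements S i Fin.< elements S j
elements-mono-< (true  ∷ S) {zero}  {suc j} i<j       = s≤s z≤n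
elements-mono-< (true  ∷ S) {suc i} {suc j} (s≤s i<j) = s≤s (elements-mono-< S i<j)
elements-mono-< (false ∷ S) i<j                       = s≤s (elements-mono-< S i<j)

elements-injective : ∀ {n} (S : Subset n) {i j} → elements S i ≡ elements S j → i ≡ j
elements-injective S {i} {j} eq with Fin.<-cmp i j
... | tri< i<j _ _ = contradiction (cong Fin.toℕ eq) (ℕ.<⇒≢ (elements-mono-< S i<j))
... | tri≈ _ i≡j _ = i≡j
... | tri> _ _ i>j = contradiction (cong Fin.toℕ (sym eq)) (ℕ.<⇒≢ (elements-mono-< S i>j))

elements-surjective : ∀ {n} (S : Subset n) {u} → u ∈ₛ S → ∃ λ i → elements S i ≡ u
elements-surjective (true  ∷ S) here       = zero , refl
elements-surjective (true  ∷ S) (there u∈) = let i , eq = elements-surjective S u∈ in suc i , cong suc eq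
elements-surjective (false ∷ S) (there u∈) = let i , eq = elements-surjective S u∈ in i , cong suc eq

Unique-allFin⇒length≤ : ∀ {n} {xs : List (Fin n)} → Unique xs → length xs ≤ n
Unique-allFin⇒length≤ {n} xs! =
  ℕ.≤-trans (Unique-⊆⇒length≤ xs! (λ _ → ∈-allFin _)) (ℕ.≤-reflexive (length-tabulate id))

-- Sorted pairs and triples as names of vertex sets.

sort₂ : ∀ {n} → Fin n → Fin n → Fin n × Fin n
sort₂ u v with u Fin.<? v
... | yes _ = u , v
... | no  _ = v , u

sort₂-injective : ∀ {n} (v : Fin n) {x y} → sort₂ v x ≡ sort₂ v y → x ≡ y
sort₂-injective v {x} {y} eq with v Fin.<? x | v Fin.<? y
... | yes _ | yes _ = proj₂ (,-injective eq)
... | yes _ | no  _ = let p , q = ,-injective eq in trans q p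
... | no  _ | yes _ = let p , q = ,-injective eq in trans p q
... | no  _ | no  _ = proj₁ (,-injective eq)

toList₃ : ∀ {a} {A : Set a} → A × A × A → List A
toList₃ (u , v , w) = u ∷ v ∷ w ∷ []

sort₃ : ∀ {n} → Fin n → Fin n → Fin n → Fin n × Fin n × Fin n
sort₃ u v w with u Fin.<? v | v Fin.<? w | u Fin.<? w
... | yes _ | yes _ | _     = u , v , w
... | yes _ | no  _ | yes _ = u , w , v
... | yes _ | no  _ | no  _ = w , u , v
... | no  _ | _     | yes _ = v , u , w
... | no  _ | yes _ | no  _ = v , w , u
... | no  _ | no  _ | no  _ = w , v , u

sort₃-↭ : ∀ {n} (u v w : Fin n) → toList₃ (sort₃ u v w) ↭ u ∷ v ∷ w ∷ []
sort₃-↭ u v w with u Fin.<? v | v Fin.<? w | u Fin.<? w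
... | yes _ | yes _ | _     = refl
... | yes _ | no  _ | yes _ = prep u (swap w v refl)
... | yes _ | no  _ | no  _ = ↭-trans (swap w u refl) (prep u (swap w v refl))
... | no  _ | _     | yes _ = swap v u refl
... | no  _ | yes _ | no  _ = ↭-trans (prep v (swap w u refl)) (swap v u refl)
... | no  _ | no  _ | no  _ =
  ↭-trans (swap w v refl) (↭-trans (prep v (swap w u refl)) (swap v u refl))

-- Sorting only permutes, so triples with the same sorted form are permutations of each other, and
-- the common entry `v` cancels.
sort₃-≡⇒↭ : ∀ {n} (v : Fin n) {x y z w} → sort₃ v x y ≡ sort₃ v z w → x ∷ y ∷ [] ↭ z ∷ w ∷ []
sort₃-≡⇒↭ v {x} {y} {z} {w} eq = drop-∷
  (↭-trans (↭-sym (sort₃-↭ v x y))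
           (subst (λ τ → toList₃ τ ↭ v ∷ z ∷ w ∷ []) (sym eq) (sort₃-↭ v z w)))

sort₃-injective : ∀ {n} (v x : Fin n) {y z} → sort₃ v x y ≡ sort₃ v x z → y ≡ z
sort₃-injective v x eq with refl ← ↭-singleton-inv (drop-∷ (sort₃-≡⇒↭ v eq)) = refl

-- Counting pairs of vertices.

allPairs : ∀ n → List (Fin n × Fin n)
allPairs n = cartesianProduct (allFin n) (allFin n)

∈-allPairs : ∀ {n} (u v : Fin n) → (u , v) ∈ allPairs n
∈-allPairs u v = ∈-cartesianProduct⁺ (∈-allFin u) (∈-allFin v)

allPairs-! : ∀ n → Unique (allPairs n)
allPairs-! n = Unique.cartesianProduct⁺ (Unique.allFin⁺ n) (Unique.allFin⁺ n)

Increasing? : ∀ {n} ((u , v) : Fin n × Fin n) → Dec (u Fin.< v)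
Increasing? (u , v) = u Fin.<? v

pairs : ∀ n → List (Fin n × Fin n)
pairs n = filter Increasing? (allPairs n)

-- The pairs starting at `zero` and the shifted pairs of the remaining vertices account for the two
-- terms of Pascal's rule.
length-pairs : ∀ n → length (pairs n) ≤ n C 2
length-pairs zero    = z≤n
length-pairs (suc n) = begin
  length (pairs (suc n))
    ≤⟨ Unique-⊆-++⇒length≤ starts (Unique.filter⁺ Increasing? (allPairs-! (suc n)))
         (λ {(u , v)} uv∈ → split u v (proj₂ (∈-filter⁻ Increasing? {xs = allPairs (suc n)} uv∈))) ⟩
  length starts + length rests
    ≡⟨ cong₂ _+_ (trans (length-map _ (allFin n)) (length-tabulate id)) (length-map _ (pairs n)) ⟩
  n + length (pairs n)
    ≤⟨ ℕ.+-monoʳ-≤ n (length-pairs n) ⟩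
  n + n C 2
    ≡⟨ cong (_+ n C 2) (nC1≡n n) ⟨
  n C 1 + n C 2
    ≡⟨ nCk+nC[k+1]≡[n+1]C[k+1] n 1 ⟩
  suc n C 2 ∎
  where
  open ℕ.≤-Reasoning
  starts rests : List (Fin (suc n) × Fin (suc n))
  starts = map (λ j → zero , suc j) (allFin n)
  rests  = map (λ (u , v) → suc u , suc v) (pairs n)
  split : ∀ u v → u Fin.< v → (u , v) ∈ starts ++ rests
  split zero    (suc v) _         = ∈-++⁺ˡ (∈-map⁺ _ (∈-allFin v))
  split (suc u) (suc v) (s≤s u<v) =
    ∈-++⁺ʳ starts (∈-map⁺ _ (∈-filter⁺ Increasing? (∈-allPairs u v) u<v))

-- Edges, non-edges, colors and rainbow triangles.

module GraphProperties {ℓ : Level} {Color : Set ℓ} (_≟_ : DecidableEquality Color) where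

  open EdgeColored _≟_
  open Graph

  module _ {n : ℕ} (G : Graph n) where

    Edge? : ((u , v) : Fin n × Fin n) → Dec (u Fin.< v × Adj G u v)
    Edge? = λ (u , v) → (u Fin.<? v) ×-dec Adj? G u v

    NonEdge? : ((u , v) : Fin n × Fin n) → Dec (u Fin.< v × ¬ Adj G u v)
    NonEdge? = λ (u , v) → (u Fin.<? v) ×-dec ¬? (Adj? G u v)

    Rainbow? : ((u , v , w) : Fin n × Fin n × Fin n) →
               Dec (u Fin.< v × v Fin.< w × RainbowTriangle G u v w)
    Rainbow? = λ (u , v , w) → (u Fin.<? v) ×-dec (v Fin.<? w) ×-dec RainbowTriangle? G u v w

    nonEdges : List (Fin n × Fin n)
    nonEdges = filter NonEdge? (allPairs n)

    #nonEdges : ℕ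
    #nonEdges = length nonEdges

    colors : List Color
    colors = deduplicate _≟_ (mapMaybe (uncurry (color G)) (edges G))

    allTriples : List (Fin n × Fin n × Fin n)
    allTriples = cartesianProduct (allFin n) (allPairs n)

    edges-! : Unique (edges G)
    edges-! = Unique.filter⁺ Edge? (allPairs-! n)

    nonEdges-! : Unique nonEdges
    nonEdges-! = Unique.filter⁺ NonEdge? (allPairs-! n)

    rainbowTriangles-! : Unique (rainbowTriangles G)
    rainbowTriangles-! =
      Unique.filter⁺ Rainbow? (Unique.cartesianProduct⁺ (Unique.allFin⁺ n) (allPairs-! n))

    colors-! : Unique colors
    colors-! = deduplicate-! _≟_ _

    just⇒Adj : ∀ {u v a} → color G u v ≡ just a → Adj G u v
    just⇒Adj eq = subst Is-just (sym eq) (Maybe.just tt)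

    Adj⇒just : ∀ {u v} → Adj G u v → ∃ λ a → color G u v ≡ just a
    Adj⇒just {u} {v} uv with just a ← color G u v = a , refl

    Adj-sym : ∀ {u v} → Adj G u v → Adj G v u
    Adj-sym {u} {v} = subst Is-just (symmetric G u v)

    Adj⇒≢ : ∀ {u v} → Adj G u v → u ≢ v
    Adj⇒≢ {u} uu refl with () ← subst Is-just (loopless G u) uu

    ≮∧Adj⇒> : ∀ {u v} → ¬ (u Fin.< v) → Adj G u v → v Fin.< u
    ≮∧Adj⇒> u≮v uv = ℕ.≤∧≢⇒< (ℕ.≮⇒≥ u≮v) (Adj⇒≢ uv ∘ sym ∘ Fin.toℕ-injective)

    ∈-nonEdges⁺ : ∀ {u v} → u Fin.< v → ¬ Adj G u v → (u , v) ∈ nonEdges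
    ∈-nonEdges⁺ {u} {v} u<v ¬uv = ∈-filter⁺ NonEdge? (∈-allPairs u v) (u<v , ¬uv)

    ∈-nonEdges⁻ : ∀ {u v} → (u , v) ∈ nonEdges → u Fin.< v × ¬ Adj G u v
    ∈-nonEdges⁻ uv∈ = proj₂ (∈-filter⁻ NonEdge? {xs = allPairs n} uv∈)

    sort₂-∈-nonEdges : ∀ {u v} → u ≢ v → ¬ Adj G u v → sort₂ u v ∈ nonEdges
    sort₂-∈-nonEdges {u} {v} u≢v ¬uv with u Fin.<? v
    ... | yes u<v = ∈-nonEdges⁺ u<v ¬uv
    ... | no  u≮v = ∈-nonEdges⁺ (ℕ.≤∧≢⇒< (ℕ.≮⇒≥ u≮v) (u≢v ∘ sym ∘ Fin.toℕ-injective)) (¬uv ∘ Adj-sym)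

    ∈-colors⁺ : ∀ {u v a} → color G u v ≡ just a → a ∈ colors
    ∈-colors⁺ {u} {v} {a} uv≡a = ∈-deduplicate⁺ _≟_ (found (Fin.<-cmp u v))
      where
      found : _ → a ∈ mapMaybe (uncurry (color G)) (edges G)
      found (tri< u<v _ _) = ∈-mapMaybe⁺ (uncurry (color G))
        (∈-filter⁺ Edge? (∈-allPairs u v) (u<v , just⇒Adj uv≡a)) uv≡a
      found (tri≈ _ u≡v _) = contradiction u≡v (Adj⇒≢ (just⇒Adj uv≡a))
      found (tri> _ _ v<u) = ∈-mapMaybe⁺ (uncurry (color G))
        (∈-filter⁺ Edge? (∈-allPairs v u) (v<u , Adj-sym (just⇒Adj uv≡a)))
        (trans (symmetric G v u) uv≡a)

    ∈-colors⁻ : ∀ {a} → a ∈ colors → ∃₂ λ u v → color G u v ≡ just a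
    ∈-colors⁻ a∈ =
      let (u , v) , _ , eq = ∈-mapMaybe⁻ (uncurry (color G)) (edges G) (∈-deduplicate⁻ _≟_ _ a∈)
      in u , v , eq

    ∈-rainbowTriangles⁺ : ∀ {u v w} → u Fin.< v → v Fin.< w → RainbowTriangle G u v w →
                          (u , v , w) ∈ rainbowTriangles G
    ∈-rainbowTriangles⁺ {u} {v} {w} u<v v<w r = ∈-filter⁺ Rainbow?
      (∈-cartesianProduct⁺ (∈-allFin u) (∈-allPairs v w)) (u<v , v<w , r)

    ∈-rainbowTriangles⁻ : ∀ {u v w} → (u , v , w) ∈ rainbowTriangles G →
                          u Fin.< v × v Fin.< w × RainbowTriangle G u v w
    ∈-rainbowTriangles⁻ τ∈ = proj₂ (∈-filter⁻ Rainbow? {xs = allTriples} τ∈)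

    -- This transposition and the next generate all reorderings of the vertices of a triangle.
    rainbow-swapˡ : ∀ {u v w} → RainbowTriangle G u v w → RainbowTriangle G v u w
    rainbow-swapˡ {u} {v} ((uv , vw , uw) , uv≢vw , uv≢uw , vw≢uw) =
      (Adj-sym uv , uw , vw) ,
      uv≢uw ∘ trans (symmetric G u v) , uv≢vw ∘ trans (symmetric G u v) , vw≢uw ∘ sym

    rainbow-swapʳ : ∀ {u v w} → RainbowTriangle G u v w → RainbowTriangle G u w v
    rainbow-swapʳ {u} {v} {w} ((uv , vw , uw) , uv≢vw , uv≢uw , vw≢uw) =
      (uw , Adj-sym vw , uv) ,
      (λ eq → vw≢uw (trans (symmetric G v w) (sym eq))) , uv≢uw ∘ sym ,
      (λ eq → uv≢vw (trans (sym eq) (symmetric G w v)))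

    sort₃-∈-rainbowTriangles : ∀ {u v w} → RainbowTriangle G u v w →
                               sort₃ u v w ∈ rainbowTriangles G
    sort₃-∈-rainbowTriangles {u} {v} {w} r@((uv , vw , uw) , _)
      with u Fin.<? v | v Fin.<? w | u Fin.<? w
    ... | yes u<v | yes v<w | _       = ∈-rainbowTriangles⁺ u<v v<w r
    ... | yes u<v | no  v≮w | yes u<w = ∈-rainbowTriangles⁺ u<w (≮∧Adj⇒> v≮w vw) (rainbow-swapʳ r)
    ... | yes u<v | no  v≮w | no  u≮w =
      ∈-rainbowTriangles⁺ (≮∧Adj⇒> u≮w uw) u<v (rainbow-swapˡ (rainbow-swapʳ r))
    ... | no  u≮v | _       | yes u<w = ∈-rainbowTriangles⁺ (≮∧Adj⇒> u≮v uv) u<w (rainbow-swapˡ r)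
    ... | no  u≮v | yes v<w | no  u≮w =
      ∈-rainbowTriangles⁺ v<w (≮∧Adj⇒> u≮w uw) (rainbow-swapʳ (rainbow-swapˡ r))
    ... | no  u≮v | no  v≮w | no  u≮w = ∈-rainbowTriangles⁺ (≮∧Adj⇒> v≮w vw) (≮∧Adj⇒> u≮v uv)
      (rainbow-swapˡ (rainbow-swapʳ (rainbow-swapˡ r)))

    -- Edges and non-edges are disjoint, duplicate-free families of increasing pairs. This is what
    -- turns a lower bound on `m G` into a bound on the non-edges.
    m+#nonEdges≤nC2 : m G + #nonEdges ≤ n C 2
    m+#nonEdges≤nC2 = ℕ.≤-trans
      (injective-disjoint⇒length≤ id edges-! nonEdges-!
        (λ {(u , v)} uv∈ → ∈-filter⁺ Increasing? (∈-allPairs u v) (proj₁ (edge uv∈)))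
        (λ {(u , v)} uv∈ → ∈-filter⁺ Increasing? (∈-allPairs u v) (proj₁ (∈-nonEdges⁻ uv∈)))
        (λ uv∈ uv∈′ → proj₂ (∈-nonEdges⁻ uv∈′) (proj₂ (edge uv∈))))
      (length-pairs n)
      where
      edge : ∀ {u v} → (u , v) ∈ edges G → u Fin.< v × Adj G u v
      edge uv∈ = proj₂ (∈-filter⁻ Edge? {xs = allPairs n} uv∈)

  -- Induced subgraphs.

  module _ {n : ℕ} (G : Graph n) (S : Subset n) where

    private
      e : Fin ∣ S ∣ → Fin n
      e = elements S

    ∈-colors-induced⁺ : ∀ {u v a} → u ∈ₛ S → v ∈ₛ S → color G u v ≡ just a →
                        a ∈ colors (induced G S)
    ∈-colors-induced⁺ u∈S v∈S uv≡a
      with i , refl ← elements-surjective S u∈S | j , refl ← elements-surjective S v∈S =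
      ∈-colors⁺ (induced G S) {i} {j} uv≡a

    induced-complete : Complete G → Complete (induced G S)
    induced-complete G-complete i j i≢j = G-complete (e i) (e j) (i≢j ∘ elements-injective S)

    induced-complete⁻ : Complete (induced G S) → ∀ {u v} → u ∈ₛ S → v ∈ₛ S → u ≢ v → Adj G u v
    induced-complete⁻ S-complete u∈S v∈S u≢v
      with i , refl ← elements-surjective S u∈S | j , refl ← elements-surjective S v∈S =
      S-complete i j (u≢v ∘ cong e)

    embed₃ : Fin ∣ S ∣ × Fin ∣ S ∣ × Fin ∣ S ∣ → Fin n × Fin n × Fin n
    embed₃ (i , j , k) = e i , e j , e k

    embed₃-injective : ∀ {σ τ} → embed₃ σ ≡ embed₃ τ → σ ≡ τ
    embed₃-injective eq = let p , q = ,-injective eq ; q , r = ,-injective q in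
      cong₂ _,_ (elements-injective S p) (cong₂ _,_ (elements-injective S q) (elements-injective S r))

    embed₃-∈ : ∀ {τ} → τ ∈ rainbowTriangles (induced G S) → embed₃ τ ∈ rainbowTriangles G
    embed₃-∈ τ∈ = let i<j , j<k , r = ∈-rainbowTriangles⁻ (induced G S) τ∈ in
      ∈-rainbowTriangles⁺ G (elements-mono-< S i<j) (elements-mono-< S j<k) r

    -- A triangle in `ls` has a vertex outside `S`, so it is not the image of a triangle of the
    -- induced subgraph.
    #rainbowTriangles-induced-+ : ∀ {ls} → Unique ls → ls ⊆ rainbowTriangles G →
      (∀ {τ} → τ ∈ ls → ¬ All (_∈ₛ S) (toList₃ τ)) →
      #rainbowTriangles (induced G S) + length ls ≤ #rainbowTriangles G
    #rainbowTriangles-induced-+ ls! ls⊆ outside = injective-disjoint⇒length≤ {f = embed₃}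
      embed₃-injective (rainbowTriangles-! (induced G S)) ls! embed₃-∈ ls⊆
      (λ {(i , j , k)} _ τ∈ls →
        outside τ∈ls (elements-∈ S i ∷ elements-∈ S j ∷ elements-∈ S k ∷ []))

    #nonEdges-induced-+ : ∀ {ls} → Unique ls → ls ⊆ nonEdges G →
      (∀ {u v} → (u , v) ∈ ls → u ∈ₛ S → ¬ v ∈ₛ S) →
      #nonEdges (induced G S) + length ls ≤ #nonEdges G
    #nonEdges-induced-+ ls! ls⊆ outside = injective-disjoint⇒length≤
      {f = λ (i , j) → e i , e j}
      (λ eq → let p , q = ,-injective eq in cong₂ _,_ (elements-injective S p) (elements-injective S q))
      (nonEdges-! (induced G S)) ls!
      (λ ij∈ → let i<j , ¬ij = ∈-nonEdges⁻ (induced G S) ij∈ in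
        ∈-nonEdges⁺ G (elements-mono-< S i<j) ¬ij)
      ls⊆
      (λ {(i , j)} _ ij∈ls → outside ij∈ls (elements-∈ S i) (elements-∈ S j))

  -- The hypothesis says that `S` and `T` share at most one vertex, so no triangle lies in both; its
  -- first two vertices already show this. A shared vertex is allowed because modules and their
  -- complements will be glued along one.
  #rainbowTriangles-induced-+-≤ : ∀ {n} (G : Graph n) (S T : Subset n) →
    (∀ {u v} → u Fin.< v → u ∈ₛ S → u ∈ₛ T → v ∈ₛ S → ¬ v ∈ₛ T) →
    #rainbowTriangles (induced G S) + #rainbowTriangles (induced G T) ≤ #rainbowTriangles G
  #rainbowTriangles-induced-+-≤ {n} G S T small = ℕ.≤-trans
    (ℕ.≤-reflexive (cong (#rainbowTriangles (induced G S) +_) (sym (length-map embed ts))))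
    (#rainbowTriangles-induced-+ G S {map embed ts}
      (Unique.map⁺ (embed₃-injective G T) (rainbowTriangles-! (induced G T)))
      (λ τ∈ → let _ , x∈ , eq = ∈-map⁻ embed τ∈ in
        subst (_∈ rainbowTriangles G) (sym eq) (embed₃-∈ G T x∈))
      (λ τ∈ → outside (∈-map⁻ embed τ∈)))
    where
    ts = rainbowTriangles (induced G T)
    embed = embed₃ G T
    outside : ∀ {τ} → (∃ λ x → x ∈ ts × τ ≡ embed x) → ¬ All (_∈ₛ S) (toList₃ τ)
    outside ((i , j , k) , x∈ , refl) (i∈ ∷ j∈ ∷ _) =
      small (elements-mono-< T (proj₁ (∈-rainbowTriangles⁻ (induced G T) x∈)))
        i∈ (elements-∈ T i) j∈ (elements-∈ T j)

-- Subsets given by decidable predicates, and their sizes.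

module _ {n p} {P : Fin n → Set p} (P? : ∀ u → Dec (P u)) where

  ⟦_⟧ : Subset n
  ⟦_⟧ = tabulate (does ∘ P?)

  ∈-⟦⟧⁺ : ∀ {u} → P u → u ∈ₛ ⟦_⟧
  ∈-⟦⟧⁺ {u} pu = Vec.lookup⇒[]= u ⟦_⟧ (trans (Vec.lookup∘tabulate (does ∘ P?) u) (dec-true (P? u) pu))

  ∈-⟦⟧⁻ : ∀ {u} → u ∈ₛ ⟦_⟧ → P u
  ∈-⟦⟧⁻ {u} u∈ with P? u | trans (sym (Vec.lookup∘tabulate (does ∘ P?) u)) (Vec.[]=⇒lookup u∈)
  ... | yes pu | _ = pu

∣p∪q∣≤∣p∣+∣q∣ : ∀ {n} (p q : Subset n) → ∣ p ∪ q ∣ ≤ ∣ p ∣ + ∣ q ∣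
∣p∪q∣≤∣p∣+∣q∣ []          []          = z≤n
∣p∪q∣≤∣p∣+∣q∣ (true  ∷ p) (true  ∷ q) = s≤s (ℕ.≤-trans (∣p∪q∣≤∣p∣+∣q∣ p q) (ℕ.+-monoʳ-≤ ∣ p ∣ (ℕ.n≤1+n ∣ q ∣)))
∣p∪q∣≤∣p∣+∣q∣ (true  ∷ p) (false ∷ q) = s≤s (∣p∪q∣≤∣p∣+∣q∣ p q)
∣p∪q∣≤∣p∣+∣q∣ (false ∷ p) (true  ∷ q) =
  ℕ.≤-trans (s≤s (∣p∪q∣≤∣p∣+∣q∣ p q)) (ℕ.≤-reflexive (sym (ℕ.+-suc ∣ p ∣ ∣ q ∣)))
∣p∪q∣≤∣p∣+∣q∣ (false ∷ p) (false ∷ q) = ∣p∪q∣≤∣p∣+∣q∣ p q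

∣p∣+∣∁p∣≡n : ∀ {n} (p : Subset n) → ∣ p ∣ + ∣ ∁ p ∣ ≡ n
∣p∣+∣∁p∣≡n p = trans (cong (∣ p ∣ +_) (Subset.∣∁p∣≡n∸∣p∣ p)) (ℕ.m+[n∸m]≡n (Subset.∣p∣≤n p))

Nonempty⇒0<∣p∣ : ∀ {n} {p : Subset n} → Nonempty p → 0 < ∣ p ∣
Nonempty⇒0<∣p∣ {p = p} (_ , x∈p) = ℕ.≤-trans (s≤s z≤n) (Fin.toℕ<n (proj₁ (elements-surjective p x∈p)))

∉⇒∣p∣<n : ∀ {n} {p : Subset n} {x} → x ∉ₛ p → ∣ p ∣ < n
∉⇒∣p∣<n {p = p} x∉p = subst (∣ p ∣ <_) (∣p∣+∣∁p∣≡n p)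
  (ℕ.m<m+n ∣ p ∣ (Nonempty⇒0<∣p∣ (_ , Subset.x∉p⇒x∈∁p x∉p)))

-- Arithmetic of deletions and decompositions.

regroup : ∀ n t m p q → n + (t + m) + suc (p + q) ≡ suc n + ((t + p) + (m + q))
regroup = solve-∀

interchange : ∀ n₁ n₂ t₁ t₂ → n₁ + t₁ + (n₂ + t₂) ≡ n₁ + n₂ + (t₁ + t₂)
interchange = solve-∀

-- The second part cannot exceed its bound, so the first must attain its own. Both decompositions
-- fit this inequality: for a cut the second `suc` is the color of the cut, for a module it pays for
-- the vertex counted twice.
tight-part : ∀ {n₁ n₂ t t₁ t₂ c₁ c₂} → n₁ + n₂ + t ≤ suc c₁ + suc c₂ → t₁ + t₂ ≤ t →
             c₂ < n₂ + t₂ → n₁ + t₁ ≤ suc c₁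
tight-part {n₁} {n₂} {t} {t₁} {t₂} {c₁} {c₂} tight t₁+t₂≤t c₂< =
  ℕ.+-cancelʳ-≤ (n₂ + t₂) _ _ (begin
    n₁ + t₁ + (n₂ + t₂)   ≡⟨ interchange n₁ n₂ t₁ t₂ ⟩
    n₁ + n₂ + (t₁ + t₂)   ≤⟨ ℕ.+-monoʳ-≤ (n₁ + n₂) t₁+t₂≤t ⟩
    n₁ + n₂ + t           ≤⟨ tight ⟩
    suc c₁ + suc c₂       ≤⟨ ℕ.+-monoʳ-≤ (suc c₁) c₂< ⟩
    suc c₁ + (n₂ + t₂)    ∎)
  where open ℕ.≤-Reasoning

-- With both parts obeying the bound, counting alone shows that no rainbow triangle crosses the cut.
tight-triangles : ∀ {n₁ n₂ t t₁ t₂ c₁ c₂} → n₁ + n₂ + t ≤ suc c₁ + suc c₂ →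
                  c₁ < n₁ + t₁ → c₂ < n₂ + t₂ → t ≤ t₁ + t₂
tight-triangles {n₁} {n₂} {t} {t₁} {t₂} {c₁} {c₂} tight c₁< c₂< =
  ℕ.+-cancelˡ-≤ (n₁ + n₂) _ _ (begin
    n₁ + n₂ + t           ≤⟨ tight ⟩
    suc c₁ + suc c₂       ≤⟨ ℕ.+-mono-≤ c₁< c₂< ⟩
    n₁ + t₁ + (n₂ + t₂)   ≡⟨ interchange n₁ n₂ t₁ t₂ ⟩
    n₁ + n₂ + (t₁ + t₂)   ∎)
  where open ℕ.≤-Reasoning

-- The color bound and its equality case.

module Extremal {ℓ : Level} {Color : Set ℓ} (_≟_ : DecidableEquality Color) where

  open EdgeColored _≟_
  open Graph
  open GraphProperties _≟_
  open DecMembership _≟_ using (_∈?_)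

  -- A strict inequality replaces a subtraction of one. `Tight` is the opposite inequality, so the
  -- two together give equality by antisymmetry.
  Bounded : ∀ {n} → Graph n → Set
  Bounded {n} G = c G < n + (#rainbowTriangles G + #nonEdges G)

  Tight : ∀ {n} → Graph n → Set
  Tight {n} G = n + (#rainbowTriangles G + #nonEdges G) ≤ suc (c G)

  complete⇒#nonEdges≡0 : ∀ {n} (G : Graph n) → Complete G → #nonEdges G ≡ 0
  complete⇒#nonEdges≡0 G G-complete = ℕ.n≤0⇒n≡0 (Unique-⊆⇒length≤ {ys = []} (nonEdges-! G)
    λ uv∈ → let u<v , ¬uv = ∈-nonEdges⁻ G uv∈ in
      contradiction (G-complete _ _ (λ { refl → ℕ.<-irrefl refl u<v })) ¬uv)

  module _ {n : ℕ} (G : Graph n) where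

    NonNeighbor? : ∀ u x → Dec (u ≢ x × ¬ Adj G u x)
    NonNeighbor? u x = ¬? (u Fin.≟ x) ×-dec ¬? (Adj? G u x)

    nonNeighbors : Fin n → List (Fin n)
    nonNeighbors u = filter (NonNeighbor? u) (allFin n)

    MaxNonNeighbors : Fin n → Set
    MaxNonNeighbors v = ∀ u → length (nonNeighbors u) ≤ length (nonNeighbors v)

  -- Deleting a vertex.

  module Vertex {n : ℕ} (G : Graph n) (v : Fin n) where

    G-v : Graph _
    G-v = induced G (∁ ⁅ v ⁆)

    New? : ∀ a → Dec (a ∉ colors G-v)
    New? a = ¬? (a ∈? colors G-v)

    newColors : List Color
    newColors = filter New? (colors G)

    -- The edge from `v` to `x` exists and its color occurs only at `v`. The `just` excludes
    -- non-neighbors, whose color is `nothing`.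
    Private : Fin n → Set ℓ
    Private x = color G v x ∈ map just newColors

    ≢⇒∈∁ : ∀ {x} → x ≢ v → x ∈ₛ ∁ ⁅ v ⁆
    ≢⇒∈∁ x≢v = Subset.x∉p⇒x∈∁p (Subset.x≢y⇒x∉⁅y⁆ x≢v)

    v∉∁ : ¬ v ∈ₛ ∁ ⁅ v ⁆
    v∉∁ = Subset.x∈p⇒x∉∁p (Subset.x∈⁅x⁆ v)

    suc-∣∁⁅v⁆∣ : suc ∣ ∁ ⁅ v ⁆ ∣ ≡ n
    suc-∣∁⁅v⁆∣ = begin
      suc ∣ ∁ ⁅ v ⁆ ∣          ≡⟨ cong suc (Subset.∣∁p∣≡n∸∣p∣ ⁅ v ⁆) ⟩
      suc (n ∸ ∣ ⁅ v ⁆ ∣)      ≡⟨ cong (λ k → suc (n ∸ k)) (Subset.∣⁅x⁆∣≡1 v) ⟩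
      suc (n ∸ 1)              ≡⟨ ℕ.m+[n∸m]≡n (ℕ.≤-trans (s≤s z≤n) (Fin.toℕ<n v)) ⟩
      n                        ∎
      where open ≡-Reasoning

    c≤c[G-v]+#newColors : c G ≤ c G-v + length newColors
    c≤c[G-v]+#newColors = Unique-⊆-++⇒length≤ (colors G-v) (colors-! G) split
      where
      split : colors G ⊆ colors G-v ++ newColors
      split {a} a∈ with a ∈? colors G-v
      ... | yes a∈′ = ∈-++⁺ˡ a∈′
      ... | no  a∉  = ∈-++⁺ʳ (colors G-v) (∈-filter⁺ New? a∈ a∉)

    #nonEdges[G-v]+ : #nonEdges G-v + length (nonNeighbors G v) ≤ #nonEdges G
    #nonEdges[G-v]+ = ℕ.≤-trans
      (ℕ.≤-reflexive (cong (#nonEdges G-v +_) (sym (length-map (sort₂ v) (nonNeighbors G v)))))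
      (#nonEdges-induced-+ G (∁ ⁅ v ⁆)
        (Unique.map⁺ (sort₂-injective v) (Unique.filter⁺ (NonNeighbor? G v) (Unique.allFin⁺ n)))
        (λ uw∈ → sub (∈-map⁻ (sort₂ v) uw∈))
        (λ uw∈ → outside (∈-map⁻ (sort₂ v) uw∈)))
      where
      sub : ∀ {p} → (∃ λ x → x ∈ nonNeighbors G v × p ≡ sort₂ v x) → p ∈ nonEdges G
      sub (x , x∈ , refl) =
        let _ , v≢x , ¬vx = ∈-filter⁻ (NonNeighbor? G v) {xs = allFin n} x∈ in
        sort₂-∈-nonEdges G v≢x ¬vx
      outside : ∀ {u w} → (∃ λ x → x ∈ nonNeighbors G v × (u , w) ≡ sort₂ v x) →
                u ∈ₛ ∁ ⁅ v ⁆ → ¬ w ∈ₛ ∁ ⁅ v ⁆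
      outside (x , _ , eq) u∈ w∈ with v Fin.<? x
      outside (x , _ , refl) u∈ w∈ | yes _ = v∉∁ u∈
      outside (x , _ , refl) u∈ w∈ | no  _ = v∉∁ w∈

    #rainbowTriangles[G-v]+ : ∀ {ls} → Unique ls → ls ⊆ rainbowTriangles G →
      (∀ {τ} → τ ∈ ls → v ∈ toList₃ τ) →
      #rainbowTriangles G-v + length ls ≤ #rainbowTriangles G
    #rainbowTriangles[G-v]+ ls! ls⊆ v∈ = #rainbowTriangles-induced-+ G (∁ ⁅ v ⁆) ls! ls⊆
      (λ τ∈ all∈ → v∉∁ (All.lookup all∈ (v∈ τ∈)))

    -- An edge avoiding `v` would keep its color alive in `G-v`.
    newColor⇒edge : ∀ {a} → a ∈ newColors → ∃ λ x → color G v x ≡ just a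
    newColor⇒edge {a} a∈ with a∈G , a∉ ← ∈-filter⁻ New? {xs = colors G} a∈
      with u , w , uw≡a ← ∈-colors⁻ G a∈G with u Fin.≟ v | w Fin.≟ v
    ... | yes refl | _        = w , uw≡a
    ... | no _     | yes refl = u , trans (symmetric G v u) uw≡a
    ... | no u≢v   | no w≢v   =
      contradiction (∈-colors-induced⁺ G (∁ ⁅ v ⁆) (≢⇒∈∁ u≢v) (≢⇒∈∁ w≢v) uw≡a) a∉

    -- A single equation of lists gives the number of representatives, the distinctness of their
    -- colors and their privacy all at once.
    representatives : ∃ λ xs → map (color G v) xs ≡ map just newColors
    representatives = choose newColors id
      where
      choose : ∀ as → as ⊆ newColors → ∃ λ xs → map (color G v) xs ≡ map just as
      choose []       _   = [] , refl
      choose (a ∷ as) as⊆ =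
        let x , eq = newColor⇒edge (as⊆ (here refl)) ; xs , eqs = choose as (as⊆ ∘ there) in
        x ∷ xs , cong₂ _∷_ eq eqs

    Private⇒Adj : ∀ {x} → Private x → Adj G v x
    Private⇒Adj x∈ = let _ , _ , eq = ∈-map⁻ just x∈ in just⇒Adj G eq

    Private⇒≢ : ∀ {x} → Private x → x ≢ v
    Private⇒≢ x∈ = Adj⇒≢ G (Private⇒Adj x∈) ∘ sym

    -- The edge `yz`, if present, survives in `G-v`, where no private color occurs.
    private-color : ∀ {x y z} → Private x → y ≢ v → z ≢ v → color G v x ≢ color G y z
    private-color x∈ y≢v z≢v eq with a , a∈ , vx≡a ← ∈-map⁻ just x∈ =
      proj₂ (∈-filter⁻ New? {xs = colors G} a∈)
        (∈-colors-induced⁺ G (∁ ⁅ v ⁆) (≢⇒∈∁ y≢v) (≢⇒∈∁ z≢v) (trans (sym eq) vx≡a))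

    private-rainbow : ∀ {x y} → Private x → Adj G v y → Adj G x y →
      color G v x ≢ color G v y → color G x y ≢ color G v y → RainbowTriangle G v x y
    private-rainbow x∈ vy xy vx≢vy xy≢vy =
      (Private⇒Adj x∈ , xy , vy) ,
      private-color x∈ (Private⇒≢ x∈) (Adj⇒≢ G vy ∘ sym) , vx≢vy , xy≢vy

    private-private-rainbow : ∀ {x y} → Private x → Private y → Adj G x y →
      color G v x ≢ color G v y → RainbowTriangle G v x y
    private-private-rainbow x∈ y∈ xy vx≢vy = private-rainbow x∈ (Private⇒Adj y∈) xy vx≢vy
      (private-color y∈ (Private⇒≢ x∈) (Private⇒≢ y∈) ∘ sym)

    module Representatives {x xs} (eq : map (color G v) (x ∷ xs) ≡ map just newColors) where

      Private-representative : ∀ {y} → y ∈ x ∷ xs → Private y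
      Private-representative {y} y∈ = subst (color G v y ∈_) eq (∈-map⁺ (color G v) y∈)

      distinct : Unique (map (color G v) (x ∷ xs))
      distinct = subst Unique (sym eq)
        (Unique.map⁺ just-injective (Unique.filter⁺ New? (colors-! G)))

      #representatives : suc (length xs) ≡ length newColors
      #representatives = begin
        suc (length xs)                     ≡⟨ cong suc (length-map (color G v) xs) ⟨
        length (map (color G v) (x ∷ xs))   ≡⟨ cong length eq ⟩
        length (map just newColors)         ≡⟨ length-map just newColors ⟩
        length newColors                    ∎
        where open ≡-Reasoning

      xs-! : Unique xs
      xs-! = AllPairs.tail (Unique.map⁻ {f = color G v} distinct)

      color-x≢ : ∀ {y} → y ∈ xs → color G v x ≢ color G v y
      color-x≢ y∈ = All.lookup (AllPairs.head distinct) (∈-map⁺ (color G v) y∈)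

      x≢ : ∀ {y} → y ∈ xs → x ≢ y
      x≢ y∈ refl = color-x≢ y∈ refl

      -- Every representative other than `x` is charged through its pair with `x`: to a rainbow
      -- triangle at `v` if the two are adjacent, to a non-neighbor of `x` otherwise.
      adjacent nonadjacent : List (Fin n)
      adjacent    = filter (Adj? G x) xs
      nonadjacent = filter (¬? ∘ Adj? G x) xs

      triangles : List (Fin n × Fin n × Fin n)
      triangles = map (sort₃ v x) adjacent

      triangles-! : Unique triangles
      triangles-! = Unique.map⁺ (sort₃-injective v x) (Unique.filter⁺ (Adj? G x) xs-!)

      ∈-triangles⁻ : ∀ {τ} → τ ∈ triangles → ∃ λ y → y ∈ xs × τ ≡ sort₃ v x y × RainbowTriangle G v x y
      ∈-triangles⁻ τ∈ =
        let y , y∈ , eq = ∈-map⁻ (sort₃ v x) τ∈ ; y∈xs , xy = ∈-filter⁻ (Adj? G x) {xs = xs} y∈ in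
        y , y∈xs , eq , private-private-rainbow (Private-representative (here refl))
          (Private-representative (there y∈xs)) xy (color-x≢ y∈xs)

      triangles-⊆ : triangles ⊆ rainbowTriangles G
      triangles-⊆ τ∈ = let _ , _ , eq , r = ∈-triangles⁻ τ∈ in
        subst (_∈ rainbowTriangles G) (sym eq) (sort₃-∈-rainbowTriangles G r)

      v∈triangles : ∀ {τ} → τ ∈ triangles → v ∈ toList₃ τ
      v∈triangles τ∈ = let y , _ , eq , _ = ∈-triangles⁻ τ∈ in
        subst (λ τ → v ∈ toList₃ τ) (sym eq) (∈-resp-↭ (↭-sym (sort₃-↭ v x y)) (here refl))

      #rainbowTriangles[G-v]+#adjacent :
        #rainbowTriangles G-v + length adjacent ≤ #rainbowTriangles G
      #rainbowTriangles[G-v]+#adjacent = ℕ.≤-trans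
        (ℕ.≤-reflexive (cong (#rainbowTriangles G-v +_) (sym (length-map (sort₃ v x) adjacent))))
        (#rainbowTriangles[G-v]+ triangles-! triangles-⊆ v∈triangles)

      -- The `suc` stands for `x` itself.
      #newColors≤ : length newColors ≤ suc (length adjacent + length nonadjacent)
      #newColors≤ = subst (_≤ suc (length adjacent + length nonadjacent)) #representatives
        (s≤s (Unique-⊆-++⇒length≤ adjacent xs-! split))
        where
        split : xs ⊆ adjacent ++ nonadjacent
        split {y} y∈ with Adj? G x y
        ... | yes xy = ∈-++⁺ˡ (∈-filter⁺ (Adj? G x) y∈ xy)
        ... | no ¬xy = ∈-++⁺ʳ adjacent (∈-filter⁺ (¬? ∘ Adj? G x) y∈ ¬xy)

      -- These non-edges at `x` survive in `G-v`, so only their number is used: when `v` has the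
      -- most non-neighbors, at least as many non-edges at `v` disappear.
      #nonadjacent≤ : length nonadjacent ≤ length (nonNeighbors G x)
      #nonadjacent≤ = Unique-⊆⇒length≤ (Unique.filter⁺ (¬? ∘ Adj? G x) xs-!)
        λ y∈ → let y∈xs , ¬xy = ∈-filter⁻ (¬? ∘ Adj? G x) {xs = xs} y∈ in
          ∈-filter⁺ (NonNeighbor? G x) (∈-allFin _) (x≢ y∈xs , ¬xy)

    Bounded-extend : MaxNonNeighbors G v → Bounded G-v → Bounded G
    Bounded-extend maximal bounded =
      subst (λ k → c G < k + (#rainbowTriangles G + #nonEdges G)) suc-∣∁⁅v⁆∣ (extend representatives)
      where
      open ℕ.≤-Reasoning
      n′ = ∣ ∁ ⁅ v ⁆ ∣
      extend : (∃ λ xs → map (color G v) xs ≡ map just newColors) →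
               c G < suc n′ + (#rainbowTriangles G + #nonEdges G)
      extend ([] , eq) = begin
        suc (c G)                                     ≤⟨ s≤s c≤c[G-v]+#newColors ⟩
        suc (c G-v + length newColors)                ≡⟨ cong (λ k → suc (c G-v + k)) #newColors≡0 ⟩
        suc (c G-v + 0)                               ≡⟨ cong suc (ℕ.+-identityʳ (c G-v)) ⟩
        suc (c G-v)                                   ≤⟨ bounded ⟩
        -- With no color lost, restoring `v` enlarges only the right side, which gains at least one
        -- from `n′` to `suc n′`.
        n′ + (#rainbowTriangles G-v + #nonEdges G-v)  ≤⟨ ℕ.+-mono-≤ (ℕ.n≤1+n n′) (ℕ.+-mono-≤
          (ℕ.m+n≤o⇒m≤o (#rainbowTriangles G-v) (#rainbowTriangles[G-v]+ {[]} [] (λ ()) (λ ())))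
          (ℕ.m+n≤o⇒m≤o (#nonEdges G-v) #nonEdges[G-v]+)) ⟩
        suc n′ + (#rainbowTriangles G + #nonEdges G)  ∎
        where
        #newColors≡0 : length newColors ≡ 0
        #newColors≡0 = trans (sym (length-map just newColors)) (cong length (sym eq))
      extend (x ∷ xs , eq) = begin
        suc (c G)                                     ≤⟨ s≤s c≤c[G-v]+#newColors ⟩
        suc (c G-v) + length newColors                ≤⟨ ℕ.+-mono-≤ bounded #newColors≤ ⟩
        n′ + (#rainbowTriangles G-v + #nonEdges G-v) + suc (length adjacent + length nonadjacent)
          -- The summand `suc` becomes the vertex `v`; the two lengths are added to the triangles
          -- and the non-edges of `G-v`.
          ≡⟨ regroup n′ (#rainbowTriangles G-v) (#nonEdges G-v) (length adjacent) (length nonadjacent) ⟩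
        suc n′ + ((#rainbowTriangles G-v + length adjacent) + (#nonEdges G-v + length nonadjacent))
          ≤⟨ ℕ.+-monoʳ-≤ (suc n′) (ℕ.+-mono-≤ #rainbowTriangles[G-v]+#adjacent
               (ℕ.≤-trans (ℕ.+-monoʳ-≤ _ (ℕ.≤-trans #nonadjacent≤ (maximal x))) #nonEdges[G-v]+)) ⟩
        suc n′ + (#rainbowTriangles G + #nonEdges G)  ∎
        where open Representatives eq

    -- The equality case at the deleted vertex.

    module _ (bounded : Bounded G-v) (tight : Tight G) where

      open ℕ.≤-Reasoning

      private
        n′ = ∣ ∁ ⁅ v ⁆ ∣

        tight′ : suc n′ + (#rainbowTriangles G + #nonEdges G) ≤ suc (c G-v) + length newColors
        tight′ = ℕ.≤-trans
          (subst (λ k → k + (#rainbowTriangles G + #nonEdges G) ≤ suc (c G)) (sym suc-∣∁⁅v⁆∣) tight)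
          (s≤s c≤c[G-v]+#newColors)

      -- `G` attains the bound and `G-v` obeys it, so the lost vertex, triangles and non-edges
      -- cannot outnumber the lost colors. The list is arbitrary because three choices matter:
      -- empty, `triangles`, and `triangles` with one more entry.
      #triangles-at-v< : ∀ {ls} → Unique ls → ls ⊆ rainbowTriangles G → (∀ {τ} → τ ∈ ls → v ∈ toList₃ τ) →
                         length ls + length (nonNeighbors G v) < length newColors
      #triangles-at-v< {ls} ls! ls⊆ v∈ =
        ℕ.+-cancelˡ-≤ (n′ + (#rainbowTriangles G-v + #nonEdges G-v)) _ _ (begin
          n′ + (#rainbowTriangles G-v + #nonEdges G-v) + suc (length ls + length (nonNeighbors G v))
            ≡⟨ regroup n′ (#rainbowTriangles G-v) (#nonEdges G-v) (length ls) (length (nonNeighbors G v)) ⟩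
          suc n′ + ((#rainbowTriangles G-v + length ls) + (#nonEdges G-v + length (nonNeighbors G v)))
            ≤⟨ ℕ.+-monoʳ-≤ (suc n′) (ℕ.+-mono-≤ (#rainbowTriangles[G-v]+ ls! ls⊆ v∈) #nonEdges[G-v]+) ⟩
          suc n′ + (#rainbowTriangles G + #nonEdges G)
            ≤⟨ tight′ ⟩
          suc (c G-v) + length newColors
            ≤⟨ ℕ.+-monoˡ-≤ _ bounded ⟩
          n′ + (#rainbowTriangles G-v + #nonEdges G-v) + length newColors ∎)

      module _ (maximal : MaxNonNeighbors G v) (complete-if-tight : Tight G-v → Complete G-v)
               {x xs} (eq : map (color G v) (x ∷ xs) ≡ map just newColors) where

        open Representatives eq

        -- The accounting of `Bounded-extend` read backwards: slack in `G-v` would persist in `G`.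
        Tight-restrict : Tight G-v
        Tight-restrict = ℕ.+-cancelʳ-≤ (suc (length adjacent + length nonadjacent)) _ _ (begin
          n′ + (#rainbowTriangles G-v + #nonEdges G-v) + suc (length adjacent + length nonadjacent)
            ≡⟨ regroup n′ (#rainbowTriangles G-v) (#nonEdges G-v) (length adjacent) (length nonadjacent) ⟩
          suc n′ + ((#rainbowTriangles G-v + length adjacent) + (#nonEdges G-v + length nonadjacent))
            ≤⟨ ℕ.+-monoʳ-≤ (suc n′) (ℕ.+-mono-≤ #rainbowTriangles[G-v]+#adjacent
                 (ℕ.≤-trans (ℕ.+-monoʳ-≤ _ (ℕ.≤-trans #nonadjacent≤ (maximal x))) #nonEdges[G-v]+)) ⟩
          suc n′ + (#rainbowTriangles G + #nonEdges G)
            ≤⟨ tight′ ⟩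
          suc (c G-v) + length newColors
            ≤⟨ ℕ.+-monoʳ-≤ (suc (c G-v)) #newColors≤ ⟩
          suc (c G-v) + suc (length adjacent + length nonadjacent) ∎)

        -- All representatives lie in `G-v`, which is complete once it is tight.
        #nonadjacent≡0 : length nonadjacent ≡ 0
        #nonadjacent≡0 = ℕ.n≤0⇒n≡0 (Unique-⊆⇒length≤ {ys = []}
          (Unique.filter⁺ (¬? ∘ Adj? G x) xs-!)
          λ y∈ → let y∈xs , ¬xy = ∈-filter⁻ (¬? ∘ Adj? G x) {xs = xs} y∈ in
            contradiction (induced-complete⁻ G (∁ ⁅ v ⁆) (complete-if-tight Tight-restrict)
              (≢⇒∈∁ (Private⇒≢ (Private-representative (here refl))))
              (≢⇒∈∁ (Private⇒≢ (Private-representative (there y∈xs)))) (x≢ y∈xs)) ¬xy)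

        #newColors≤#adjacent : length newColors ≤ suc (length adjacent)
        #newColors≤#adjacent = begin
          length newColors                                ≤⟨ #newColors≤ ⟩
          suc (length adjacent + length nonadjacent)      ≡⟨ cong (λ k → suc (length adjacent + k)) #nonadjacent≡0 ⟩
          suc (length adjacent + 0)                       ≡⟨ cong suc (ℕ.+-identityʳ _) ⟩
          suc (length adjacent)                           ∎

        #triangles≡ : length triangles ≡ length adjacent
        #triangles≡ = length-map (sort₃ v x) adjacent

        -- The new colors number at most one more than `triangles`, which leaves no room for a
        -- non-neighbor in `#triangles-at-v<`.
        #nonNeighbors≤0 : length (nonNeighbors G v) ≤ 0
        #nonNeighbors≤0 = ℕ.+-cancelˡ-≤ (length triangles) _ _ (ℕ.≤-pred (begin
          suc (length triangles + length (nonNeighbors G v))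
            ≤⟨ #triangles-at-v< triangles-! triangles-⊆ v∈triangles ⟩
          length newColors            ≤⟨ #newColors≤#adjacent ⟩
          suc (length adjacent)       ≡⟨ cong suc #triangles≡ ⟨
          suc (length triangles)      ≡⟨ cong suc (ℕ.+-identityʳ _) ⟨
          suc (length triangles + 0)  ∎))

        -- The vertex with the most non-neighbors has none.
        Tight⇒Complete : Complete G
        Tight⇒Complete u w u≢w with Adj? G u w
        ... | yes uw = uw
        ... | no ¬uw = contradiction
          (ℕ.≤-trans (∈-length (∈-filter⁺ (NonNeighbor? G u) (∈-allFin w) (u≢w , ¬uw)))
                     (ℕ.≤-trans (maximal u) #nonNeighbors≤0))
          (λ ())

        -- One rainbow triangle at `v` beyond those in `triangles` would violate `#triangles-at-v<`.
        -- The permutation says that one of `y`, `z` is `x` and the other belongs to `xs`.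
        rainbow⇒representatives : ∀ {y z} → RainbowTriangle G v y z →
                                  ∃ λ y′ → y′ ∈ xs × y ∷ z ∷ [] ↭ x ∷ y′ ∷ []
        rainbow⇒representatives {y} {z} r =
          let y′ , y′∈ , eq , _ = ∈-triangles⁻ (decidable-stable (τ ∈₃? triangles) not-outside)
          in y′ , y′∈ , sort₃-≡⇒↭ v eq
          where
          open DecMembership (Product.≡-dec Fin._≟_ (Product.≡-dec Fin._≟_ Fin._≟_))
            using () renaming (_∈?_ to _∈₃?_)
          τ = sort₃ v y z
          ∷-⊆ : τ ∷ triangles ⊆ rainbowTriangles G
          ∷-⊆ (here refl) = sort₃-∈-rainbowTriangles G r
          ∷-⊆ (there τ∈)  = triangles-⊆ τ∈
          v∈∷ : ∀ {σ} → σ ∈ τ ∷ triangles → v ∈ toList₃ σ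
          v∈∷ (here refl) = ∈-resp-↭ (↭-sym (sort₃-↭ v y z)) (here refl)
          v∈∷ (there σ∈)  = v∈triangles σ∈
          not-outside : ¬ τ ∉ triangles
          not-outside τ∉ = ℕ.<-irrefl refl (begin-strict
            length newColors              ≤⟨ #newColors≤#adjacent ⟩
            suc (length adjacent)         ≡⟨ cong suc #triangles≡ ⟨
            length (τ ∷ triangles)        ≤⟨ ℕ.m≤m+n _ _ ⟩
            length (τ ∷ triangles) + length (nonNeighbors G v)
              <⟨ #triangles-at-v< (All.tabulate (λ { σ∈ refl → τ∉ σ∈ }) ∷ triangles-!) ∷-⊆ v∈∷ ⟩
            length newColors              ∎)

  -- Positivity excludes the empty graph, where the bound would read `0 < 0`. The two statements
  -- travel together because the equality case uses both for smaller graphs.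
  Claim : ℕ → Set ℓ
  Claim n = 0 < n → (G : Graph n) → Bounded G × (Tight G → 𝒢 (#rainbowTriangles G) G)

  -- Complete extremal graphs.

  module _ {n : ℕ} (G : Graph n) (G-complete : Complete G) where

    drop-nonEdges : #rainbowTriangles G + #nonEdges G ≡ #rainbowTriangles G
    drop-nonEdges = trans (cong (#rainbowTriangles G +_) (complete⇒#nonEdges≡0 G G-complete))
      (ℕ.+-identityʳ _)

    Tight-complete : Tight G → n + #rainbowTriangles G ≤ suc (c G)
    Tight-complete = subst (λ k → n + k ≤ suc (c G)) drop-nonEdges

    Bounded-complete : Bounded G → c G < n + #rainbowTriangles G
    Bounded-complete = subst (λ k → c G < n + k) drop-nonEdges

    Shape⇒𝒢 : Bounded G → Tight G → Shape (#rainbowTriangles G) G → 𝒢 (#rainbowTriangles G) G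
    Shape⇒𝒢 bounded tight G-shape = record
      { complete   = G-complete
      ; #triangles = refl
      -- Antisymmetry gives `suc (c G)` on one side, so `_∸ 1` just removes this `suc`.
      ; #colors    = cong (_∸ 1) (ℕ.≤-antisym (Bounded-complete bounded) (Tight-complete tight))
      ; shape      = G-shape
      }

  module CompleteStep {n : ℕ} (ih : ∀ {n′} → n′ < n → Claim n′)
                      (G : Graph n) (G-complete : Complete G)
                      (tight : n + #rainbowTriangles G ≤ suc (c G)) where

    module Part (S : Subset n) (0<∣S∣ : 0 < ∣ S ∣) (∣S∣<n : ∣ S ∣ < n) where

      S-complete : Complete (induced G S)
      S-complete = induced-complete G S G-complete

      bounded : c (induced G S) < ∣ S ∣ + #rainbowTriangles (induced G S)
      bounded = Bounded-complete (induced G S) S-complete (proj₁ (ih ∣S∣<n 0<∣S∣ (induced G S)))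

      tight⇒𝒢 : ∣ S ∣ + #rainbowTriangles (induced G S) ≤ suc (c (induced G S)) →
                𝒢 (#rainbowTriangles (induced G S)) (induced G S)
      tight⇒𝒢 = proj₂ (ih ∣S∣<n 0<∣S∣ (induced G S)) ∘
        subst (λ k → ∣ S ∣ + k ≤ suc (c (induced G S))) (sym (drop-nonEdges (induced G S) S-complete))

    -- Monochromatic cuts and modules.

    module _ (V₁ : Subset n) (V₁≢∅ : Nonempty V₁) (V₂≢∅ : Nonempty (∁ V₁))
             (monochromatic : MonochromaticBetween G V₁ (∁ V₁)) where

      private
        V₂ : Subset n
        V₂ = ∁ V₁

        ∣V₁∣+∣V₂∣≡n : ∣ V₁ ∣ + ∣ V₂ ∣ ≡ n
        ∣V₁∣+∣V₂∣≡n = ∣p∣+∣∁p∣≡n V₁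

        0<∣V₁∣ : 0 < ∣ V₁ ∣
        0<∣V₁∣ = Nonempty⇒0<∣p∣ V₁≢∅

        0<∣V₂∣ : 0 < ∣ V₂ ∣
        0<∣V₂∣ = Nonempty⇒0<∣p∣ V₂≢∅

      open Part V₁ 0<∣V₁∣ (subst (∣ V₁ ∣ <_) ∣V₁∣+∣V₂∣≡n (ℕ.m<m+n ∣ V₁ ∣ 0<∣V₂∣))
        renaming (bounded to bounded₁; tight⇒𝒢 to tight⇒𝒢₁)
      open Part V₂ 0<∣V₂∣ (subst (∣ V₂ ∣ <_) ∣V₁∣+∣V₂∣≡n (ℕ.m<n+m ∣ V₂ ∣ 0<∣V₁∣))
        renaming (bounded to bounded₂; tight⇒𝒢 to tight⇒𝒢₂)

      private
        cut-adjacent : ∀ {u w} → u ∈ₛ V₁ → w ∈ₛ V₂ → Adj G u w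
        cut-adjacent {u} {w} u∈ w∈ = G-complete u w λ { refl → Subset.x∈p⇒x∉∁p u∈ w∈ }

        cut-color : ∃ λ a → color G (proj₁ V₁≢∅) (proj₁ V₂≢∅) ≡ just a
        cut-color = Adj⇒just G (cut-adjacent (proj₂ V₁≢∅) (proj₂ V₂≢∅))

        -- The `suc` is the one color of the cut, which may also occur inside a side.
        c≤ : c G ≤ c (induced G V₁) + suc (c (induced G V₂))
        c≤ = Unique-⊆-++⇒length≤ (colors (induced G V₁)) (colors-! G) split
          where
          cut-edge : ∀ {u w a} → u ∈ₛ V₁ → w ∈ₛ V₂ → color G u w ≡ just a → a ≡ proj₁ cut-color
          cut-edge u∈ w∈ uw≡a = just-injective (trans (sym uw≡a) (trans
            (monochromatic u∈ w∈ (proj₂ V₁≢∅) (proj₂ V₂≢∅) (cut-adjacent u∈ w∈)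
              (cut-adjacent (proj₂ V₁≢∅) (proj₂ V₂≢∅)))
            (proj₂ cut-color)))
          split : colors G ⊆ colors (induced G V₁) ++ proj₁ cut-color ∷ colors (induced G V₂)
          split {a} a∈ with u , w , uw≡a ← ∈-colors⁻ G a∈ with u Subset.∈? V₁ | w Subset.∈? V₁
          ... | yes u∈ | yes w∈ = ∈-++⁺ˡ (∈-colors-induced⁺ G V₁ u∈ w∈ uw≡a)
          ... | no u∉  | no w∉  = ∈-++⁺ʳ (colors (induced G V₁)) (there
            (∈-colors-induced⁺ G V₂ (Subset.x∉p⇒x∈∁p u∉) (Subset.x∉p⇒x∈∁p w∉) uw≡a))
          ... | yes u∈ | no w∉  = ∈-++⁺ʳ (colors (induced G V₁)) (here
            (cut-edge u∈ (Subset.x∉p⇒x∈∁p w∉) uw≡a))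
          ... | no u∉  | yes w∈ = ∈-++⁺ʳ (colors (induced G V₁)) (here
            (cut-edge w∈ (Subset.x∉p⇒x∈∁p u∉) (trans (symmetric G w u) uw≡a)))

        t₁+t₂≤t : #rainbowTriangles (induced G V₁) + #rainbowTriangles (induced G V₂) ≤
                  #rainbowTriangles G
        t₁+t₂≤t = #rainbowTriangles-induced-+-≤ G V₁ V₂
          (λ _ u∈₁ u∈₂ → contradiction u∈₂ (Subset.x∈p⇒x∉∁p u∈₁))

        tight₁₂ : ∣ V₁ ∣ + ∣ V₂ ∣ + #rainbowTriangles G ≤
                  suc (c (induced G V₁)) + suc (c (induced G V₂))
        tight₁₂ = ℕ.≤-trans
          (subst (λ k → k + #rainbowTriangles G ≤ suc (c G)) (sym ∣V₁∣+∣V₂∣≡n) tight) (s≤s c≤)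

      -- The bound for each side forces equality on the other, so the induction hypothesis puts both
      -- sides in their classes.
      cut⇒Shape : Shape (#rainbowTriangles G) G
      cut⇒Shape = partition V₁ V₁≢∅ V₂≢∅ monochromatic
        (tight⇒𝒢₁ (tight-part {∣ V₁ ∣} {∣ V₂ ∣} tight₁₂ t₁+t₂≤t bounded₂))
        (tight⇒𝒢₂ (tight-part {∣ V₂ ∣} {∣ V₁ ∣}
          (subst₂ _≤_ (cong (_+ #rainbowTriangles G) (ℕ.+-comm ∣ V₁ ∣ ∣ V₂ ∣))
            (ℕ.+-comm (suc (c (induced G V₁))) _) tight₁₂)
          (ℕ.≤-trans (ℕ.≤-reflexive (ℕ.+-comm (#rainbowTriangles (induced G V₂)) _)) t₁+t₂≤t)
          bounded₁))
        (ℕ.≤-antisym t₁+t₂≤t (tight-triangles {∣ V₁ ∣} {∣ V₂ ∣} tight₁₂ bounded₁ bounded₂))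

    -- P together with v is a module: every other vertex y sees it in the single
    -- color of vy.  Hence a cut of the complement W of P, which contains v,
    -- becomes a cut of G by putting P on the side of v.
    module _ {P : Fin n → Set ℓ} (P? : ∀ u → Dec (P u)) {v : Fin n} (¬P-v : ¬ P v)
             (homogeneous : ∀ {x y} → P x → ¬ P y → y ≢ v → color G x y ≡ color G v y)
             (rainbow⇒P : ∀ {y z} → RainbowTriangle G v y z → P y)
             {x} (Px : P x) {y} (y≢v : y ≢ v) (¬Py : ¬ P y) where

      private
        -- `W` is the complement of `P` and `M` adds `v` to `P`, so they cover all vertices and meet
        -- exactly in `v`. They miss `x` and `y` respectively, so the induction hypothesis applies
        -- to both.
        W M : Subset n
        W = ⟦ ¬? ∘ P? ⟧
        M = ⁅ v ⁆ ∪ ∁ W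

        W⁺ : ∀ {u} → ¬ P u → u ∈ₛ W
        W⁺ = ∈-⟦⟧⁺ (¬? ∘ P?)

        W⁻ : ∀ {u} → u ∈ₛ W → ¬ P u
        W⁻ = ∈-⟦⟧⁻ (¬? ∘ P?)

        v∈M : v ∈ₛ M
        v∈M = Subset.x∈p∪q⁺ (inj₁ (Subset.x∈⁅x⁆ v))

        M⁺ : ∀ {u} → P u → u ∈ₛ M
        M⁺ Pu = Subset.x∈p∪q⁺ (inj₂ (Subset.x∉p⇒x∈∁p (λ u∈W → W⁻ u∈W Pu)))

        M⁻ : ∀ {u} → u ∈ₛ M → u ∈ₛ W → u ≡ v
        M⁻ u∈M u∈W with Subset.x∈p∪q⁻ ⁅ v ⁆ (∁ W) u∈M
        ... | inj₁ u∈⁅v⁆ = Subset.x∈⁅y⁆⇒x≡y v u∈⁅v⁆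
        ... | inj₂ u∈∁W  = contradiction u∈W (Subset.x∈∁p⇒x∉p u∈∁W)

        ∣W∣+∣M∣≤1+n : ∣ W ∣ + ∣ M ∣ ≤ suc n
        ∣W∣+∣M∣≤1+n = begin
          ∣ W ∣ + ∣ M ∣                   ≤⟨ ℕ.+-monoʳ-≤ ∣ W ∣ (∣p∪q∣≤∣p∣+∣q∣ ⁅ v ⁆ (∁ W)) ⟩
          ∣ W ∣ + (∣ ⁅ v ⁆ ∣ + ∣ ∁ W ∣)   ≡⟨ cong (λ k → ∣ W ∣ + (k + ∣ ∁ W ∣)) (Subset.∣⁅x⁆∣≡1 v) ⟩
          ∣ W ∣ + suc ∣ ∁ W ∣             ≡⟨ ℕ.+-suc ∣ W ∣ ∣ ∁ W ∣ ⟩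
          suc (∣ W ∣ + ∣ ∁ W ∣)           ≡⟨ cong suc (∣p∣+∣∁p∣≡n W) ⟩
          suc n                           ∎
          where open ℕ.≤-Reasoning

        module W = Part W (Nonempty⇒0<∣p∣ (v , W⁺ ¬P-v)) (∉⇒∣p∣<n {x = x} λ x∈W → W⁻ x∈W Px)
        module M = Part M (Nonempty⇒0<∣p∣ (v , v∈M)) (∉⇒∣p∣<n {x = y} λ y∈M → y≢v (M⁻ y∈M (W⁺ ¬Py)))

        -- Edges between `P` and `W` bring no further color: one ending in `v` lies in `M`, and any
        -- other has by homogeneity the color of an edge at `v` inside `W`.
        c≤ : c G ≤ c (induced G W) + c (induced G M)
        c≤ = Unique-⊆-++⇒length≤ (colors (induced G W)) (colors-! G) split
          where
          mixed : ∀ {u w a} → P u → ¬ P w → color G u w ≡ just a →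
                  a ∈ colors (induced G W) ++ colors (induced G M)
          mixed {u} {w} Pu ¬Pw uw≡a with w Fin.≟ v
          ... | yes refl = ∈-++⁺ʳ (colors (induced G W)) (∈-colors-induced⁺ G M (M⁺ Pu) v∈M uw≡a)
          ... | no w≢v   = ∈-++⁺ˡ (∈-colors-induced⁺ G W (W⁺ ¬P-v) (W⁺ ¬Pw)
            (trans (sym (homogeneous Pu ¬Pw w≢v)) uw≡a))
          split : colors G ⊆ colors (induced G W) ++ colors (induced G M)
          split {a} a∈ with u , w , uw≡a ← ∈-colors⁻ G a∈ with P? u | P? w
          ... | no p  | no q  = ∈-++⁺ˡ (∈-colors-induced⁺ G W (W⁺ p) (W⁺ q) uw≡a)
          ... | yes p | yes q = ∈-++⁺ʳ (colors (induced G W)) (∈-colors-induced⁺ G M (M⁺ p) (M⁺ q) uw≡a)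
          ... | yes p | no q  = mixed p q uw≡a
          ... | no p  | yes q = mixed q p (trans (symmetric G w u) uw≡a)

        𝒢-W : 𝒢 (#rainbowTriangles (induced G W)) (induced G W)
        𝒢-W = W.tight⇒𝒢 (tight-part {∣ W ∣} {∣ M ∣}
          (begin
            ∣ W ∣ + ∣ M ∣ + #rainbowTriangles G               ≤⟨ ℕ.+-monoˡ-≤ _ ∣W∣+∣M∣≤1+n ⟩
            suc (n + #rainbowTriangles G)                     ≤⟨ s≤s tight ⟩
            suc (suc (c G))                                   ≤⟨ s≤s (s≤s c≤) ⟩
            suc (suc (c (induced G W) + c (induced G M)))     ≡⟨ cong suc (ℕ.+-suc _ _) ⟨
            suc (c (induced G W)) + suc (c (induced G M))     ∎)
          (#rainbowTriangles-induced-+-≤ G W M λ u<w u∈W u∈M w∈W w∈M →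
            ℕ.<-irrefl (cong Fin.toℕ (trans (M⁻ u∈M u∈W) (sym (M⁻ w∈M w∈W)))) u<w)
          M.bounded)
          where open ℕ.≤-Reasoning

        v-index : ∃ λ i → elements W i ≡ v
        v-index = elements-surjective W (W⁺ ¬P-v)

        y-index : ∃ λ i → elements W i ≡ y
        y-index = elements-surjective W (W⁺ ¬Py)

        ∣W∣≢1 : ∣ W ∣ ≢ 1
        ∣W∣≢1 ∣W∣≡1 = contradiction
          (subst (2 ≤_) ∣W∣≡1 (Unique-allFin⇒length≤ {xs = proj₁ v-index ∷ proj₁ y-index ∷ []}
            ((indices-≢ ∷ []) ∷ [] ∷ [])))
          λ { (s≤s ()) }
          where
          indices-≢ : proj₁ v-index ≢ proj₁ y-index
          indices-≢ eq = y≢v (trans (sym (proj₂ y-index))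
            (trans (cong (elements W) (sym eq)) (proj₂ v-index)))

        ¬rainbow-W : ∀ {j k} → ¬ RainbowTriangle (induced G W) (proj₁ v-index) j k
        ¬rainbow-W {j} {k} r = W⁻ (elements-∈ W j)
          (rainbow⇒P (subst (λ u → RainbowTriangle G u (elements W j) (elements W k)) (proj₂ v-index) r))

        -- A triangle on three vertices exhausts `W` and so contains `v`; if it were rainbow,
        -- `rainbow⇒P` would put another of its vertices in `P`, outside `W`.
        ¬∣W∣≡3 : ∣ W ∣ ≡ 3 → ∀ {i j k} → ¬ RainbowTriangle (induced G W) i j k
        ¬∣W∣≡3 ∣W∣≡3 {i} {j} {k} r@((ij , jk , ik) , _)
          with proj₁ v-index Fin.≟ i | proj₁ v-index Fin.≟ j | proj₁ v-index Fin.≟ k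
        ... | yes refl | _ | _ = ¬rainbow-W r
        ... | no _ | yes refl | _ = ¬rainbow-W (rainbow-swapˡ (induced G W) r)
        ... | no _ | no _ | yes refl =
          ¬rainbow-W (rainbow-swapˡ (induced G W) (rainbow-swapʳ (induced G W) r))
        ... | no v≢i | no v≢j | no v≢k = contradiction
          (subst (4 ≤_) ∣W∣≡3 (Unique-allFin⇒length≤ {xs = proj₁ v-index ∷ i ∷ j ∷ k ∷ []}
            ((v≢i ∷ v≢j ∷ v≢k ∷ []) ∷
             (Adj⇒≢ (induced G W) ij ∷ Adj⇒≢ (induced G W) ik ∷ []) ∷
             (Adj⇒≢ (induced G W) jk ∷ []) ∷ [] ∷ [])))
          λ { (s≤s (s≤s (s≤s ()))) }

        -- The contraction of `P` to `v`, expressed in the numbering of `W`.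
        retract : Fin n → Fin ∣ W ∣
        retract u with P? u
        ... | yes _ = proj₁ v-index
        ... | no ¬Pu = proj₁ (elements-surjective W (W⁺ ¬Pu))

        retract-P : ∀ {u} → P u → elements W (retract u) ≡ v
        retract-P {u} Pu with P? u
        ... | yes _       = proj₂ v-index
        ... | no ¬Pu = contradiction Pu ¬Pu

        retract-¬P : ∀ {u} → ¬ P u → elements W (retract u) ≡ u
        retract-¬P {u} ¬Pu with P? u
        ... | yes Pu = contradiction Pu ¬Pu
        ... | no ¬Pu   = proj₂ (elements-surjective W (W⁺ ¬Pu))

        retract-elements : ∀ i → retract (elements W i) ≡ i
        retract-elements i = elements-injective W (retract-¬P (W⁻ (elements-∈ W i)))

        -- By homogeneity contraction preserves every color except those within `P` and `v`, where
        -- both ends have the same image. Preimages of a monochromatic cut of `W` are therefore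
        -- monochromatic cuts of `G`.
        color-retract : ∀ {u w} → retract u ≢ retract w →
                        color G u w ≡ color (induced G W) (retract u) (retract w)
        color-retract {u} {w} u≢w = by-cases (P? u) (P? w)
          where
          by-cases : Dec (P u) → Dec (P w) → color G u w ≡ color (induced G W) (retract u) (retract w)
          by-cases (no ¬p)  (no ¬q)  = sym (cong₂ (color G) (retract-¬P ¬p) (retract-¬P ¬q))
          by-cases (yes p) (yes q) = contradiction
            (elements-injective W (trans (retract-P p) (sym (retract-P q)))) u≢w
          by-cases (yes p) (no ¬q) = trans
            (homogeneous p ¬q λ { refl → u≢w (elements-injective W
              (trans (retract-P p) (sym (retract-¬P ¬P-v)))) })
            (sym (cong₂ (color G) (retract-P p) (retract-¬P ¬q)))
          by-cases (no ¬p) (yes q) = trans (symmetric G u w) (trans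
            (homogeneous q ¬p λ { refl → u≢w (elements-injective W
              (trans (retract-¬P ¬P-v) (sym (retract-P q)))) })
            (trans (symmetric G v u)
              (sym (cong₂ (color G) (retract-¬P ¬p) (retract-P q)))))

        W-complete : Complete (induced G W)
        W-complete = induced-complete G W G-complete

        module Lift (U : Subset ∣ W ∣) (monochromatic : MonochromaticBetween (induced G W) U (∁ U)) where

          V : Subset n
          V = ⟦ (λ u → retract u Subset.∈? U) ⟧

          V⁺ : ∀ {u} → retract u ∈ₛ U → u ∈ₛ V
          V⁺ = ∈-⟦⟧⁺ (λ u → retract u Subset.∈? U)

          V⁻ : ∀ {u} → u ∈ₛ V → retract u ∈ₛ U
          V⁻ = ∈-⟦⟧⁻ (λ u → retract u Subset.∈? U)

          ∁V⁻ : ∀ {u} → u ∈ₛ ∁ V → retract u ∈ₛ ∁ U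
          ∁V⁻ u∈ = Subset.x∉p⇒x∈∁p (Subset.x∈∁p⇒x∉p u∈ ∘ V⁺)

          retract-≢ : ∀ {u w} → u ∈ₛ V → w ∈ₛ ∁ V → retract u ≢ retract w
          retract-≢ u∈ w∈ eq = Subset.x∈p⇒x∉∁p (V⁻ u∈) (subst (_∈ₛ ∁ U) (sym eq) (∁V⁻ w∈))

          elements-∈V : ∀ {i} → i ∈ₛ U → elements W i ∈ₛ V
          elements-∈V {i} i∈ = V⁺ (subst (_∈ₛ U) (sym (retract-elements i)) i∈)

          elements-∈∁V : ∀ {i} → i ∈ₛ ∁ U → elements W i ∈ₛ ∁ V
          elements-∈∁V {i} i∈ = Subset.x∉p⇒x∈∁p λ i∈V →
            Subset.x∈∁p⇒x∉p i∈ (subst (_∈ₛ U) (retract-elements i) (V⁻ i∈V))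

          monochromatic-V : MonochromaticBetween G V (∁ V)
          monochromatic-V {u} {w} {u′} {w′} u∈ w∈ u′∈ w′∈ _ _ = begin
            color G u w                                       ≡⟨ color-retract (retract-≢ u∈ w∈) ⟩
            color (induced G W) (retract u) (retract w)       ≡⟨ monochromatic (V⁻ u∈) (∁V⁻ w∈) (V⁻ u′∈) (∁V⁻ w′∈)
              (W-complete _ _ (retract-≢ u∈ w∈)) (W-complete _ _ (retract-≢ u′∈ w′∈)) ⟩
            color (induced G W) (retract u′) (retract w′)     ≡⟨ color-retract (retract-≢ u′∈ w′∈) ⟨
            color G u′ w′                                     ∎
            where open ≡-Reasoning

        lift-Shape : ∀ {k} → Shape k (induced G W) → Shape (#rainbowTriangles G) G
        lift-Shape (singleVertex ∣W∣≡1)      = contradiction ∣W∣≡1 ∣W∣≢1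
        lift-Shape (rainbowTriangle ∣W∣≡3 r) = contradiction r (¬∣W∣≡3 ∣W∣≡3)
        -- Only the cut is carried over; `cut⇒Shape` proves afresh that its sides in `G` are
        -- extremal.
        lift-Shape (partition U (i , i∈) (j , j∈) monochromatic _ _ _) =
          cut⇒Shape V (elements W i , elements-∈V i∈) (elements W j , elements-∈∁V j∈) monochromatic-V
          where open Lift U monochromatic

      module⇒Shape : Shape (#rainbowTriangles G) G
      module⇒Shape = lift-Shape (𝒢.shape 𝒢-W)

    -- The module formed by a vertex and its private neighbors.

    module _ (v : Fin n) where

      open Vertex G v

      Private? : ∀ x → Dec (Private x)
      Private? x = color G v x ∈ₘ? map just newColors
        where open DecMembership (≡-dec _≟_) using () renaming (_∈?_ to _∈ₘ?_)

      ¬Private-v : ¬ Private v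
      ¬Private-v v∈ = Private⇒≢ v∈ refl

      module _ {x xs} (eq : map (color G v) (x ∷ xs) ≡ map just newColors)
               (rainbow⇒representatives : ∀ {y z} → RainbowTriangle G v y z →
                 ∃ λ y′ → y′ ∈ xs × y ∷ z ∷ [] ↭ x ∷ y′ ∷ []) where

        open Representatives eq

        private
          rainbow⇒∈ : ∀ {y z w} → RainbowTriangle G v y z → w ∈ y ∷ z ∷ [] → w ∈ x ∷ xs
          rainbow⇒∈ r w∈ with y′ , y′∈ , σ ← rainbow⇒representatives r with ∈-resp-↭ σ w∈
          ... | here refl         = here refl
          ... | there (here refl) = there y′∈

          rainbow⇒∋x : ∀ {y z} → RainbowTriangle G v y z → x ∈ y ∷ z ∷ []
          rainbow⇒∋x r with _ , _ , σ ← rainbow⇒representatives r = ∈-resp-↭ (↭-sym σ) (here refl)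

          -- Otherwise `v`, `y`, `z` would span a rainbow triangle, making `z` a representative and
          -- hence private.
          homogeneous : ∀ {y z} → Private y → ¬ Private z → z ≢ v → color G y z ≡ color G v z
          homogeneous {y} {z} y-private z-public z≢v =
            decidable-stable (≡-dec _≟_ (color G y z) (color G v z)) λ yz≢vz →
              z-public (Private-representative (rainbow⇒∈ (private-rainbow y-private
                (G-complete v z (z≢v ∘ sym))
                (G-complete y z λ { refl → z-public y-private })
                (λ vy≡vz → z-public (subst (_∈ map just newColors) vy≡vz y-private))
                yz≢vz) (there (here refl))))

        module _ (none : ¬ ∃ λ y → y ≢ v × ¬ Private y) where

          is-private : ∀ {y} → y ≢ v → Private y
          is-private {y} y≢v = decidable-stable (Private? y) λ y-public → none (y , y≢v , y-public)

          -- A single representative means that all edges at `v` share one color, so `v` is cut off.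
          -- With two or more, the first two together with `v` exhaust the graph.
          all-private⇒Shape : ∀ {ys} → xs ≡ ys → Shape (#rainbowTriangles G) G
          all-private⇒Shape {[]} refl = cut⇒Shape ⁅ v ⁆ (v , Subset.x∈⁅x⁆ v)
            (x , Subset.x∉p⇒x∈∁p (Subset.x≢y⇒x∉⁅y⁆ (Private⇒≢ (Private-representative (here refl)))))
            λ u∈ w∈ u′∈ w′∈ _ _ → trans (color-x u∈ w∈) (sym (color-x u′∈ w′∈))
            where
            color-x : ∀ {u w} → u ∈ₛ ⁅ v ⁆ → w ∈ₛ ∁ ⁅ v ⁆ → color G u w ≡ color G v x
            color-x {u} {w} u∈ w∈ = trans (cong (λ u → color G u w) (Subset.x∈⁅y⁆⇒x≡y v u∈))
              (singleton⁻ (subst (color G v w ∈_) (sym eq)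
                (is-private λ { refl → Subset.x∈∁p⇒x∉p w∈ (Subset.x∈⁅x⁆ v) })))
          all-private⇒Shape {x′ ∷ xs′} refl = rainbowTriangle
            (ℕ.≤-antisym
              (subst (_≤ 3) (length-tabulate id) (Unique-⊆⇒length≤ (Unique.allFin⁺ n) covered))
              (Unique-allFin⇒length≤ {xs = v ∷ x ∷ x′ ∷ []}
                ((x≢v ∘ sym ∷ x′≢v ∘ sym ∷ []) ∷ (x≢x′ ∷ []) ∷ [] ∷ [])))
            (private-private-rainbow x-private x′-private (G-complete x x′ x≢x′) (color-x≢ (here refl)))
            where
            x-private : Private x
            x-private = Private-representative (here refl)
            x′-private : Private x′
            x′-private = Private-representative (there (here refl))
            x≢v : x ≢ v
            x≢v = Private⇒≢ x-private
            x′≢v : x′ ≢ v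
            x′≢v = Private⇒≢ x′-private
            x≢x′ : x ≢ x′
            x≢x′ = x≢ (here refl)
            color-x′≢ : ∀ {z} → z ∈ xs′ → color G v x′ ≢ color G v z
            color-x′≢ z∈ = All.lookup (AllPairs.head (AllPairs.tail distinct)) (∈-map⁺ (color G v) z∈)
            -- If `vz` and `vx′` differ in color, then `v`, `z`, `x′` form a rainbow triangle
            -- avoiding `x`. If they agree, `v`, `z`, `x` form one, so `z` is a representative
            -- sharing the color of `x′`, although colors of representatives are distinct.
            third : ∀ {z} → z ≢ v → z ≢ x → z ≢ x′ → ⊥
            third {z} z≢v z≢x z≢x′ = by-cases (≡-dec _≟_ (color G v z) (color G v x′))
              where
              z-private : Private z
              z-private = is-private z≢v
              z∉ : color G v z ≡ color G v x′ → z ∉ x ∷ xs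
              z∉ _       (here z≡x)          = z≢x z≡x
              z∉ _       (there (here z≡x′)) = z≢x′ z≡x′
              z∉ vz≡vx′ (there (there z∈))  = color-x′≢ z∈ (sym vz≡vx′)
              x∉ : x ∉ z ∷ x′ ∷ []
              x∉ (here x≡z)          = z≢x (sym x≡z)
              x∉ (there (here x≡x′)) = x≢x′ x≡x′
              by-cases : Dec (color G v z ≡ color G v x′) → ⊥
              by-cases (no vz≢vx′)  = x∉ (rainbow⇒∋x
                (private-private-rainbow z-private x′-private (G-complete z x′ z≢x′) vz≢vx′))
              by-cases (yes vz≡vx′) = z∉ vz≡vx′ (rainbow⇒∈
                (private-private-rainbow z-private x-private (G-complete z x z≢x)
                  λ vz≡vx → color-x≢ (here refl) (trans (sym vz≡vx) vz≡vx′)) (here refl))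
            covered : allFin n ⊆ v ∷ x ∷ x′ ∷ []
            covered {z} _ with z Fin.≟ v | z Fin.≟ x | z Fin.≟ x′
            ... | yes z≡v | _       | _        = here z≡v
            ... | no _    | yes z≡x | _        = there (here z≡x)
            ... | no _    | no _    | yes z≡x′ = there (there (here z≡x′))
            ... | no z≢v  | no z≢x  | no z≢x′  = ⊥-elim (third z≢v z≢x z≢x′)

        representatives⇒Shape : Shape (#rainbowTriangles G) G
        representatives⇒Shape = by-cases (Fin.any? (λ y → ¬? (y Fin.≟ v) ×-dec ¬? (Private? y)))
          where
          by-cases : Dec (∃ λ y → y ≢ v × ¬ Private y) → Shape (#rainbowTriangles G) G
          by-cases (yes (y , y≢v , y-public)) = module⇒Shape Private? ¬Private-v homogeneous
            (λ r → Private-representative (rainbow⇒∈ r (here refl)))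
            (Private-representative (here refl)) y≢v y-public
          by-cases (no none) = all-private⇒Shape none refl

  -- The induction and the passage from edges to tightness.

  module _ {n : ℕ} (G : Graph n) (n≡1 : n ≡ 1) where

    private
      single : (u v : Fin n) → u ≡ v
      single = subst (λ k → (u v : Fin k) → u ≡ v) (sym n≡1) λ { zero zero → refl }

      no-color : colors G ⊆ []
      no-color a∈ = let u , v , uv≡a = ∈-colors⁻ G a∈ in
        contradiction (single u v) (Adj⇒≢ G (just⇒Adj G uv≡a))

      bounded : Bounded G
      bounded = ℕ.≤-trans (s≤s (Unique-⊆⇒length≤ (colors-! G) no-color))
        (ℕ.≤-trans (ℕ.≤-reflexive (sym n≡1)) (ℕ.m≤m+n n _))

    singleVertex⇒claim : Bounded G × (Tight G → 𝒢 (#rainbowTriangles G) G)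
    singleVertex⇒claim = bounded , λ tight →
      Shape⇒𝒢 G (λ u v u≢v → contradiction (single u v) u≢v) bounded tight (singleVertex n≡1)

  module _ {n : ℕ} (1<n : 1 < n) (ih : ∀ {n′} → n′ < n → Claim n′) (G : Graph n)
           {v : Fin n} (maximal : MaxNonNeighbors G v) where

    open Vertex G v

    private
      claim-G-v : Bounded G-v × (Tight G-v → 𝒢 (#rainbowTriangles G-v) G-v)
      claim-G-v = ih (ℕ.≤-reflexive suc-∣∁⁅v⁆∣)
        (ℕ.≤-pred (subst (1 <_) (sym suc-∣∁⁅v⁆∣) 1<n)) G-v

      bounded : Bounded G
      bounded = Bounded-extend maximal (proj₁ claim-G-v)

      tight⇒𝒢 : Tight G → (∃ λ xs → map (color G v) xs ≡ map just newColors) →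
                𝒢 (#rainbowTriangles G) G
      -- Already for the empty list of triangles, `#triangles-at-v<` demands a new color.
      tight⇒𝒢 tight ([] , eq) = contradiction
        (#triangles-at-v< (proj₁ claim-G-v) tight {[]} [] (λ ()) (λ ()))
        (ℕ.≤⇒≯ (ℕ.≤-trans (ℕ.≤-reflexive #newColors≡0) z≤n))
        where
        #newColors≡0 : length newColors ≡ 0
        #newColors≡0 = trans (sym (length-map just newColors)) (cong length (sym eq))
      tight⇒𝒢 tight (x ∷ xs , eq) = Shape⇒𝒢 G G-complete bounded tight
        (CompleteStep.representatives⇒Shape ih G G-complete (Tight-complete G G-complete tight) v eq
          (rainbow⇒representatives (proj₁ claim-G-v) tight maximal G-v-complete eq))
        where
        G-v-complete : Tight G-v → Complete G-v
        G-v-complete = 𝒢.complete ∘ proj₂ claim-G-v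
        G-complete : Complete G
        G-complete = Tight⇒Complete (proj₁ claim-G-v) tight maximal G-v-complete eq

    maximal⇒claim : Bounded G × (Tight G → 𝒢 (#rainbowTriangles G) G)
    maximal⇒claim = bounded , λ tight → tight⇒𝒢 tight representatives

  claim : ∀ n → Claim n
  claim = <-rec Claim step
    where
    open Extrema ℕ.≤-totalOrder
    step : ∀ n → (∀ {n′} → n′ < n → Claim n′) → Claim n
    step n ih 0<n G with n ℕ.≟ 1
    ... | yes n≡1 = singleVertex⇒claim G n≡1
    -- The vertex `v` is the argmax of the number of non-neighbors; its default value is vertex 0,
    -- which exists since `n` is positive.
    ... | no  n≢1 = maximal⇒claim (ℕ.≤∧≢⇒< 0<n (n≢1 ∘ sym)) ih G λ u → All.lookup
      (f[xs]≤f[argmax] {f = length ∘ nonNeighbors G} (Fin.fromℕ< 0<n) (allFin n)) (∈-allFin u)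

  -- After adding `m G` to both sides, edges and non-edges combine to at most `n C 2`, and Pascal's
  -- rule absorbs the summand `n`.
  edges+colors⇒Tight : ∀ {n} (G : Graph n) →
    (n + 1) C 2 + #rainbowTriangles G ∸ 1 ≤ m G + c G → Tight G
  edges+colors⇒Tight {n} G h = ℕ.+-cancelˡ-≤ (m G) _ _ (begin
    m G + (n + (#rainbowTriangles G + #nonEdges G))   ≡⟨ shuffle (m G) n (#rainbowTriangles G) (#nonEdges G) ⟩
    n + (m G + #nonEdges G) + #rainbowTriangles G     ≤⟨ ℕ.+-monoˡ-≤ (#rainbowTriangles G) (ℕ.+-monoʳ-≤ n (m+#nonEdges≤nC2 G)) ⟩
    n + n C 2 + #rainbowTriangles G                   ≡⟨ cong (_+ #rainbowTriangles G) pascal ⟩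
    -- This inequality holds even where the subtraction truncates.
    (n + 1) C 2 + #rainbowTriangles G                 ≤⟨ ℕ.m≤n+m∸n _ 1 ⟩
    suc ((n + 1) C 2 + #rainbowTriangles G ∸ 1)       ≤⟨ s≤s h ⟩
    suc (m G + c G)                                   ≡⟨ ℕ.+-suc (m G) (c G) ⟨
    m G + suc (c G)                                   ∎)
    where
    open ℕ.≤-Reasoning
    shuffle : ∀ e n t e′ → e + (n + (t + e′)) ≡ n + (e + e′) + t
    shuffle = solve-∀
    pascal : n + n C 2 ≡ (n + 1) C 2
    pascal = trans (cong (_+ n C 2) (sym (nC1≡n n)))
      (trans (nCk+nC[k+1]≡[n+1]C[k+1] n 1) (cong (_C 2) (ℕ.+-comm 1 n)))

theorem3 : ∀ {ℓ} {Color : Set ℓ} (_≟_ : DecidableEquality Color) →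
    let open EdgeColored _≟_ in
    (k n : ℕ) .{{_ : NonZero n}} (G : Graph n) →
    n ≥ 3 * k →
    m G + c G ≥ ((n + 1) C 2) + k ∸ 1 →
    #rainbowTriangles G ≡ k →
    𝒢 k G
theorem3 _≟_ k n G _ h refl = proj₂ (claim n (>-nonZero⁻¹ n) G) (edges+colors⇒Tight G h)
  where open Extremal _≟_
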